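{- Let $p$ be an odd prime and $m,x\in\mathbb Z_p$. Then $$\sum_{k=0}^{p-1}\frac{G_k(x)}{m^k}\equiv\sum_{k=0}^{p-1}\frac{\binom xk\binom{ -1-x}k}{(1-m)^k}\pmod p\quad\text{if }m\not\equiv0,1\pmod p,$$ $$\sum_{k=0}^{p-1}\binom{2k}k\frac{G_k(x)}{(m+2)^k}\equiv\left(\frac{(m+2)(m-2)}p\right)\sum_{k=0}^{p-1}\binom{2k}k\frac{\binom xk\binom{ -1-x}k}{(2-m)^k}\pmod p\quad\text{if }m\not\equiv\pm2\pmod p.$$ Consequently, for $p>3$ and $m\in\mathbb Z_p$: $\sum_{k=0}^{p-1}\frac{G_k^{(3)}}{m^k}\equiv\sum_{k=0}^{p-1}\frac{\binom{2k}k\binom{3k}k}{(27-m)^k}\pmod p$ for $m\not\equiv0,27$; $\sum_{k=0}^{p-1}\frac{G_k^{(4)}}{m^k}\equiv\sum_{k=0}^{p-1}\frac{\binom{2k}k\binom{4k}{2k}}{(64-m)^k}\pmod p$ for $m\not\equiv0,64$; $\sum_{k=0}^{p-1}\frac{G_k^{(6)}}{m^k}\equiv\sum_{k=0}^{p-1}\frac{\binom{3k}k\binom{6k}{3k}}{(432-m)^k}\pmod p$ for $m\not\equiv0,432$; $\sum_{k=0}^{p-1}\binom{2k}k\frac{G_k^{(3)}}{m^k}\equiv\left(\frac{m(m-108)}p\right)\sum_{k=0}^{p-1}\frac{\binom{2k}k^2\binom{3k}k}{(108-m)^k}\pmod p$ for $m\not\equiv0,108$; $\sum_{k=0}^{p-1}\binom{2k}k\frac{G_k^{(4)}}{m^k}\equiv\left(\frac{m(m-256)}p\right)\sum_{k=0}^{p-1}\frac{\binom{2k}k^2\binom{4k}{2k}}{(256-m)^k}\pmod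 p$ for $m\not\equiv0,256$; $\sum_{k=0}^{p-1}\binom{2k}k\frac{G_k^{(6)}}{m^k}\equiv\left(\frac{m(m-1728)}p\right)\sum_{k=0}^{p-1}\frac{\binom{2k}k\binom{3k}k\binom{6k}{3k}}{(1728-m)^k}\pmod p$ for $m\not\equiv0,1728$ (all non-congruences modulo $p$).
   Context: For real $x$ and integer $k\ge0$, $\binom xk=x(x-1)\cdots(x-k+1)/k!$; $G_n(x)=\sum_{k=0}^n\binom nk(-1)^k\binom xk\binom{ -1-x}k$. For a prime $p$, $\mathbb Z_p$ is the set of rationals with denominator prime to $p$; congruences mod $p$ are in $\mathbb Z_p$. $\left(\frac{\cdot}{p}\right)$ is the Legendre symbol. $G_n^{(3)}=27^nG_n(-\tfrac13)=\sum_{k=0}^n\binom nk(-1)^k\binom{2k}k\binom{3k}k27^{n-k}$, $G_n^{(4)}=64^nG_n(-\tfrac14)=\sum_{k=0}^n\binom nk(-1)^k\binom{2k}k\binom{4k}{2k}64^{n-k}$, $G_n^{(6)}=432^nG_n(-\tfrac16)=\sum_{k=0}^n\binom nk(-1)^k\binom{3k}k\binom{6k}{3k}432^{n-k}$. -}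

module Defs where

open import Data.Bool using (Bool; if_then_else_)
open import Data.Nat as ℕ using (ℕ; zero; suc; _!)
open import Data.Nat.Properties using (_!≢0)
open import Data.Nat.Combinatorics using (_C_)
open import Data.Nat.Divisibility using (_∣_; _∣?_)
open import Data.Integer as ℤ using (ℤ; +_; -[1+_])
open import Data.Rational as ℚ using (ℚ; ↥_; ↧ₙ_; 0ℚ; 1ℚ; _+_; _*_; _-_; -_; _/_; 1/_)
open import Data.Rational.Properties using (_≟_)
open import Data.List using (List; upTo)
open import Data.Bool.ListAction using (any)
open import Relation.Nullary using (¬_; yes; no)
open import Relation.Nullary.Decidable using (⌊_⌋)

ℤ→ℚ : ℤ → ℚ
ℤ→ℚ z = z / 1

ℕ→ℚ : ℕ → ℚ
ℕ→ℚ n = (+ n) / 1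

_^_ : ℚ → ℕ → ℚ
q ^ zero = 1ℚ
q ^ suc n = q * (q ^ n)

-- total inverse (inv 0 = 0); only ever applied to nonzero arguments
inv : ℚ → ℚ
inv q with q ≟ 0ℚ
... | yes _ = 0ℚ
... | no q≢0 = (1/ q) {{ℚ.≢-nonZero q≢0}}

sumQ : ℕ → (ℕ → ℚ) → ℚ
sumQ zero f = 0ℚ
sumQ (suc n) f = sumQ n f + f n

falling : ℚ → ℕ → ℚ
falling x zero = 1ℚ
falling x (suc k) = falling x k * (x - ℕ→ℚ k)

binom : ℚ → ℕ → ℚ
binom x k = falling x k * ((+ 1) / (k !)) {{k !≢0}}

G : ℕ → ℚ → ℚ
G n x = sumQ (suc n) λ k →
  ℕ→ℚ (n C k) * ((- 1ℚ) ^ k) * binom x k * binom (- 1ℚ - x) k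

G3 G4 G6 : ℕ → ℚ
G3 n = (ℕ→ℚ 27 ^ n) * G n (- ((+ 1) / 3))
G4 n = (ℕ→ℚ 64 ^ n) * G n (- ((+ 1) / 4))
G6 n = (ℕ→ℚ 432 ^ n) * G n (- ((+ 1) / 6))

InZp : ℕ → ℚ → Set
InZp p q = ¬ (p ∣ ↧ₙ q)

Cong : ℕ → ℚ → ℚ → Set
Cong p a b = p ∣ ℤ.∣ ↥ (a - b) ∣

cong? : (p : ℕ) → ℚ → ℚ → Bool
cong? p a b = ⌊ p ∣? ℤ.∣ ↥ (a - b) ∣ ⌋

legendre : ℕ → ℚ → ℤ
legendre p a =
  if cong? p a 0ℚ then + 0
  else if any (λ y → cong? p (ℕ→ℚ y * ℕ→ℚ y) a) (upTo p) then + 1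
  else -[1+ 0 ]

{-# OPTIONS --safe #-}
module Submission where

-- Since G_k(x) = Σ_j C(k,j) (-1)^j a_j with a_j = binom x j · binom (-1-x) j, a sum Σ_k w_k G_k(x)
-- is determined by the moments Σ_k w_k C(k,j), which are evaluated modulo p.
-- For w_k = t^k, Pascal's rule together with C(p,j) ≡ 0 and t^p ≡ t gives (t/(1-t))^j.
-- For w_k = C(2k,k) u^k, put n = (p-1)/2; since -1/2 ≡ n, we have C(2k,k) ≡ C(n,k) (-4)^k, and the moments
-- reduce to the finite identity Σ_k C(n,k) C(k,j) v^k = C(n,j) v^j (1+v)^(n-j) with v = -4u.
-- The surviving factor (1+v)^n is the Legendre symbol by Euler's criterion.
-- The remaining congruences rescale m by 27, 64, 432, where a_j becomes a product of integer binomials.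

open import Defs
open import Data.Bool using (Bool; true; false; T; if_then_else_)
open import Data.Bool.ListAction using (any)
open import Data.Integer as ℤ using (ℤ; -[1+_]) renaming (+_ to pos)
import Data.Integer.Divisibility.Signed as ℤ
import Data.Integer.Properties as ℤ
open import Data.Integer.Tactic.RingSolver using () renaming (solve-∀ to solve-∀-ℤ)
open import Data.List using (upTo)
open import Data.List.Membership.Propositional using (_∈_; find; lose)
open import Data.List.Membership.Propositional.Properties using (∈-upTo⁺)
open import Data.List.Relation.Unary.Any.Properties using (any⁺; any⁻)
open import Data.Nat as ℕ using (ℕ; zero; suc; _<_; _≤_; _*_; _!; z≤n; s≤s; z<s)
open import Data.Nat.Combinatorics using (_C_; k>n⇒nCk≡0; nCk+nC[k+1]≡[n+1]C[k+1]; nCn≡1; nCk≡n!/k![n-k]!; k![n∸k]!∣n!)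
open import Data.Nat.Coprimality using (recompute)
open import Data.Nat.Divisibility using (_∣_; divides; ∣⇒≤; ∣1⇒≡1)
open import Data.Nat.DivMod using (_%_; _/_; m≡m%n+[m/n]*n; m%n<n; m/n*n≡m)
open import Data.Nat.Primality using (Prime; euclidsLemma; prime⇒nonZero; prime⇒nonTrivial; prime⇒irreducible)
import Data.Nat.Properties as ℕ
open import Data.Product using (_×_; _,_; proj₁; proj₂; map₁; map₂; ∃-syntax)
open import Data.Rational using (ℚ; mkℚ; 0ℚ; 1ℚ; -½; _+_; _-_; -_; ↥_; ↧_; ↧ₙ_; toℚᵘ) renaming (_*_ to infixl 7 _·_)
import Data.Rational as ℚ
import Data.Rational.Properties as ℚ
open import Data.Rational.Unnormalised as ℚᵘ using (mkℚᵘ; *≡*)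
import Data.Rational.Unnormalised.Properties as ℚᵘ
open import Data.Sum as Sum using (_⊎_; inj₁; inj₂; [_,_]′)
open import Data.Unit using (tt)
open import Data.Vec using (Vec; []; _∷_; replicate)
open import Data.Vec.Relation.Unary.All using (All; []; _∷_)
open import Function using (_∘_; id)
open import Relation.Binary.PropositionalEquality using (_≡_; _≢_; refl; sym; trans; cong; cong₂; subst; module ≡-Reasoning)
open import Relation.Nullary using (¬_; yes; no; contradiction)
open import Relation.Nullary.Decidable using (toWitness; fromWitness; dec⇒maybe)
open import Tactic.RingSolver using (solve-∀)
open import Tactic.RingSolver.Core.AlmostCommutativeRing using (AlmostCommutativeRing; fromCommutativeRing)

-- Both families of moments close up because the sums stop at `p - 1`. In the first, telescoping
-- leaves boundary terms at the index `p`, exactly the ones that the two congruences for `C(p,j)`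
-- and `t^p` dispose of. In the second, `C(n,k)` vanishes beyond `n < p`, so the sum covers a
-- complete row of binomials. The constant 4 comes from the exact identity
-- `C(2k,k) = (-4)^k C(-½,k)`. With `u = 1/A` the base `1 - 4u` is `D/A` as soon as `A - D = 4`,
-- which `m + 2` and `m - 2` satisfy. After division by `N` the same condition reads `L = 4N`,
-- whence 108, 256 and 1728. The Legendre symbol is defined by a search for a square root below `p`,
-- so Euler's criterion has to produce such a root. It comes from Lagrange's theorem: `1², ..., n²`
-- are already all the roots of `x^n - 1` modulo `p`.

ℚ-ring : AlmostCommutativeRing _ _
ℚ-ring = fromCommutativeRing ℚ.+-*-commutativeRing λ q → dec⇒maybe (0ℚ ℚ.≟ q)

-- The integers and naturals inside ℚ

toℚᵘ-ℤ→ℚ : ∀ a → toℚᵘ (ℤ→ℚ a) ℚᵘ.≃ mkℚᵘ a 0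
toℚᵘ-ℤ→ℚ a = ℚ.toℚᵘ-fromℚᵘ (mkℚᵘ a 0)

-- Arithmetic on ℚ renormalises by a gcd that does not reduce on variables. The law is therefore
-- checked on unnormalised fractions, where it becomes an identity of integers.
ℤ→ℚ-+ : ∀ a b → ℤ→ℚ (a ℤ.+ b) ≡ ℤ→ℚ a + ℤ→ℚ b
ℤ→ℚ-+ a b = ℚ.toℚᵘ-injective (begin
  toℚᵘ (ℤ→ℚ (a ℤ.+ b))             ≈⟨ toℚᵘ-ℤ→ℚ (a ℤ.+ b) ⟩
  mkℚᵘ (a ℤ.+ b) 0                 ≈⟨ *≡* (lemma a b) ⟩
  mkℚᵘ a 0 ℚᵘ.+ mkℚᵘ b 0           ≈⟨ ℚᵘ.+-cong (toℚᵘ-ℤ→ℚ a) (toℚᵘ-ℤ→ℚ b) ⟨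
  toℚᵘ (ℤ→ℚ a) ℚᵘ.+ toℚᵘ (ℤ→ℚ b)   ≈⟨ ℚ.toℚᵘ-homo-+ (ℤ→ℚ a) (ℤ→ℚ b) ⟨
  toℚᵘ (ℤ→ℚ a + ℤ→ℚ b)             ∎)
  where
  open ℚᵘ.≃-Reasoning
  lemma : ∀ a b → (a ℤ.+ b) ℤ.* pos 1 ≡ (a ℤ.* pos 1 ℤ.+ b ℤ.* pos 1) ℤ.* pos 1
  lemma = solve-∀-ℤ

ℤ→ℚ-* : ∀ a b → ℤ→ℚ (a ℤ.* b) ≡ ℤ→ℚ a · ℤ→ℚ b
ℤ→ℚ-* a b = ℚ.toℚᵘ-injective (begin
  toℚᵘ (ℤ→ℚ (a ℤ.* b))             ≈⟨ toℚᵘ-ℤ→ℚ (a ℤ.* b) ⟩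
  mkℚᵘ a 0 ℚᵘ.* mkℚᵘ b 0           ≈⟨ ℚᵘ.*-cong (toℚᵘ-ℤ→ℚ a) (toℚᵘ-ℤ→ℚ b) ⟨
  toℚᵘ (ℤ→ℚ a) ℚᵘ.* toℚᵘ (ℤ→ℚ b)   ≈⟨ ℚ.toℚᵘ-homo-* (ℤ→ℚ a) (ℤ→ℚ b) ⟨
  toℚᵘ (ℤ→ℚ a · ℤ→ℚ b)             ∎)
  where open ℚᵘ.≃-Reasoning

ℤ→ℚ-injective : ∀ {a b} → ℤ→ℚ a ≡ ℤ→ℚ b → a ≡ b
ℤ→ℚ-injective {a} {b} eq = ℤ.*-cancelʳ-≡ a b (pos 1) (ℚᵘ.drop-*≡* (begin
  mkℚᵘ a 0       ≈⟨ toℚᵘ-ℤ→ℚ a ⟨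
  toℚᵘ (ℤ→ℚ a)   ≡⟨ cong toℚᵘ eq ⟩
  toℚᵘ (ℤ→ℚ b)   ≈⟨ toℚᵘ-ℤ→ℚ b ⟩
  mkℚᵘ b 0       ∎))
  where open ℚᵘ.≃-Reasoning

-- The bridge from a reduced fraction to an equation between embedded integers, the form in which
-- all divisibility arguments are carried out.
q·↧q≡↥q : ∀ q → q · ℤ→ℚ (↧ q) ≡ ℤ→ℚ (↥ q)
q·↧q≡↥q q@(mkℚ n d-1 _) = ℚ.toℚᵘ-injective (begin
  toℚᵘ (q · ℤ→ℚ d)               ≈⟨ ℚ.toℚᵘ-homo-* q (ℤ→ℚ d) ⟩
  mkℚᵘ n d-1 ℚᵘ.* toℚᵘ (ℤ→ℚ d)   ≈⟨ ℚᵘ.*-cong (ℚᵘ.≃-refl {mkℚᵘ n d-1}) (toℚᵘ-ℤ→ℚ d) ⟩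
  mkℚᵘ n d-1 ℚᵘ.* mkℚᵘ d 0       ≈⟨ *≡* (ℤ.*-assoc n d (pos 1)) ⟩
  mkℚᵘ n 0                       ≈⟨ toℚᵘ-ℤ→ℚ n ⟨
  toℚᵘ (ℤ→ℚ n)                   ∎)
  where
  open ℚᵘ.≃-Reasoning
  d = pos (suc d-1)

ℕ→ℚ-+ : ∀ a b → ℕ→ℚ (a ℕ.+ b) ≡ ℕ→ℚ a + ℕ→ℚ b
ℕ→ℚ-+ a b = trans (cong ℤ→ℚ (ℤ.pos-+ a b)) (ℤ→ℚ-+ (pos a) (pos b))

ℕ→ℚ-* : ∀ a b → ℕ→ℚ (a * b) ≡ ℕ→ℚ a · ℕ→ℚ b
ℕ→ℚ-* a b = trans (cong ℤ→ℚ (ℤ.pos-* a b)) (ℤ→ℚ-* (pos a) (pos b))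

ℕ→ℚ-suc : ∀ n → ℕ→ℚ (suc n) ≡ 1ℚ + ℕ→ℚ n
ℕ→ℚ-suc = ℕ→ℚ-+ 1

ℕ→ℚ≢0 : ∀ n → .{{ℕ.NonZero n}} → ℕ→ℚ n ≢ 0ℚ
ℕ→ℚ≢0 (suc n) eq with ℤ→ℚ-injective {pos (suc n)} {pos 0} eq
... | ()

-- Inverses, cancellation and powers

q·inv : ∀ {q} → q ≢ 0ℚ → q · inv q ≡ 1ℚ
q·inv {q} q≢0 with q ℚ.≟ 0ℚ
... | yes q≡0 = contradiction q≡0 q≢0
... | no  _   = ℚ.*-inverseʳ q {{ℚ.≢-nonZero q≢0}}

inverse-unique : ∀ a b c → a · b ≡ 1ℚ → a · c ≡ 1ℚ → b ≡ c
inverse-unique a b c ab≡1 ac≡1 = begin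
  b             ≡⟨ ℚ.*-identityʳ b ⟨
  b · 1ℚ        ≡⟨ cong (b ·_) ac≡1 ⟨
  b · (a · c)   ≡⟨ lemma a b c ⟩
  (a · b) · c   ≡⟨ cong (_· c) ab≡1 ⟩
  1ℚ · c        ≡⟨ ℚ.*-identityˡ c ⟩
  c             ∎
  where
  open ≡-Reasoning
  lemma : ∀ a b c → b · (a · c) ≡ (a · b) · c
  lemma = solve-∀ ℚ-ring

·-cancelˡ : ∀ {a b c} → a ≢ 0ℚ → a · b ≡ a · c → b ≡ c
·-cancelˡ {a} {b} {c} a≢0 eq = begin
  b                 ≡⟨ lemma b ⟩
  inv a · (a · b)   ≡⟨ cong (inv a ·_) eq ⟩
  inv a · (a · c)   ≡⟨ lemma c ⟨
  c                 ∎
  where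
  open ≡-Reasoning
  assoc : ∀ x y z → x · z · y ≡ z · (x · y)
  assoc = solve-∀ ℚ-ring
  lemma : ∀ x → x ≡ inv a · (a · x)
  lemma x = trans (sym (trans (cong (_· x) (q·inv a≢0)) (ℚ.*-identityˡ x))) (assoc a x (inv a))

≢0-· : ∀ {a b} → a ≢ 0ℚ → b ≢ 0ℚ → a · b ≢ 0ℚ
≢0-· {a} a≢0 b≢0 ab≡0 = b≢0 (·-cancelˡ a≢0 (trans ab≡0 (sym (ℚ.*-zeroʳ a))))

-- A product equal to 1 already excludes `a ≡ 0ℚ`, so the default value of `inv` is never met and an
-- inverse is identified by one multiplication.
inv≡ : ∀ a b → a · b ≡ 1ℚ → inv a ≡ b
inv≡ a b ab≡1 = inverse-unique a (inv a) b (q·inv a≢0) ab≡1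
  where
  a≢0 : a ≢ 0ℚ
  a≢0 refl = ℚ.1≢0 (trans (sym ab≡1) (ℚ.*-zeroˡ b))

1^ : ∀ n → 1ℚ ^ n ≡ 1ℚ
1^ zero    = refl
1^ (suc n) = trans (ℚ.*-identityˡ (1ℚ ^ n)) (1^ n)

^-distribˡ-+ : ∀ a m n → a ^ (m ℕ.+ n) ≡ (a ^ m) · (a ^ n)
^-distribˡ-+ a zero    n = sym (ℚ.*-identityˡ (a ^ n))
^-distribˡ-+ a (suc m) n = trans (cong (a ·_) (^-distribˡ-+ a m n)) (sym (ℚ.*-assoc a (a ^ m) (a ^ n)))

^-distribʳ-· : ∀ a b n → (a · b) ^ n ≡ (a ^ n) · (b ^ n)
^-distribʳ-· a b zero    = refl
^-distribʳ-· a b (suc n) = trans (cong ((a · b) ·_) (^-distribʳ-· a b n)) (lemma a b (a ^ n) (b ^ n))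
  where
  lemma : ∀ a b x y → (a · b) · (x · y) ≡ (a · x) · (b · y)
  lemma = solve-∀ ℚ-ring

^-inverse : ∀ a b n → a · b ≡ 1ℚ → (a ^ n) · (b ^ n) ≡ 1ℚ
^-inverse a b n ab≡1 = trans (sym (^-distribʳ-· a b n)) (trans (cong (_^ n) ab≡1) (1^ n))

inv-^ : ∀ a n → a ≢ 0ℚ → inv (a ^ n) ≡ inv a ^ n
inv-^ a n a≢0 = inv≡ (a ^ n) (inv a ^ n) (^-inverse a (inv a) n (q·inv a≢0))

-- Finite sums

sumQ-cong : ∀ n {f g} → (∀ k → k < n → f k ≡ g k) → sumQ n f ≡ sumQ n g
sumQ-cong zero    eq = refl
sumQ-cong (suc n) eq = cong₂ _+_ (sumQ-cong n λ k k<n → eq k (ℕ.m<n⇒m<1+n k<n)) (eq n (ℕ.n<1+n n))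

sumQ-+ : ∀ n f g → sumQ n (λ k → f k + g k) ≡ sumQ n f + sumQ n g
sumQ-+ zero    f g = refl
sumQ-+ (suc n) f g = trans (cong (_+ (f n + g n)) (sumQ-+ n f g)) (lemma (sumQ n f) (sumQ n g) (f n) (g n))
  where
  lemma : ∀ a b c d → a + b + (c + d) ≡ a + c + (b + d)
  lemma = solve-∀ ℚ-ring

sumQ-·ˡ : ∀ n c f → sumQ n (λ k → c · f k) ≡ c · sumQ n f
sumQ-·ˡ zero    c f = sym (ℚ.*-zeroʳ c)
sumQ-·ˡ (suc n) c f = trans (cong (_+ c · f n) (sumQ-·ˡ n c f)) (sym (ℚ.*-distribˡ-+ c (sumQ n f) (f n)))

sumQ-0 : ∀ n → sumQ n (λ _ → 0ℚ) ≡ 0ℚ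
sumQ-0 zero    = refl
sumQ-0 (suc n) = trans (ℚ.+-identityʳ _) (sumQ-0 n)

sumQ-swap : ∀ m n (f : ℕ → ℕ → ℚ) →
  sumQ m (λ i → sumQ n (λ j → f i j)) ≡ sumQ n (λ j → sumQ m (λ i → f i j))
sumQ-swap zero    n f = sym (sumQ-0 n)
sumQ-swap (suc m) n f = trans (cong (_+ sumQ n (f m)) (sumQ-swap m n f)) (sym (sumQ-+ n _ (f m)))

sumQ-head : ∀ n f → sumQ (suc n) f ≡ f 0 + sumQ n (f ∘ suc)
sumQ-head zero    f = ℚ.+-comm 0ℚ (f 0)
sumQ-head (suc n) f = trans (cong (_+ f (suc n)) (sumQ-head n f)) (ℚ.+-assoc (f 0) _ (f (suc n)))

sumQ-extend : ∀ {m n} f → m ≤ n → (∀ k → m ≤ k → f k ≡ 0ℚ) → sumQ n f ≡ sumQ m f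
sumQ-extend {m} {n} f m≤n f≡0 = trans (cong (λ l → sumQ l f) (sym (ℕ.m∸n+n≡m m≤n))) (go (n ℕ.∸ m))
  where
  go : ∀ d → sumQ (d ℕ.+ m) f ≡ sumQ m f
  go zero    = refl
  go (suc d) = trans (cong₂ _+_ (go d) (f≡0 (d ℕ.+ m) (ℕ.m≤n+m m d))) (ℚ.+-identityʳ _)

C-suc : ∀ n k → ℕ→ℚ (suc n C suc k) ≡ ℕ→ℚ (n C k) + ℕ→ℚ (n C suc k)
C-suc n k = trans (cong ℕ→ℚ (sym (nCk+nC[k+1]≡[n+1]C[k+1] n k))) (ℕ→ℚ-+ (n C k) (n C suc k))

C-zero : ∀ {n k} → n < k → ℕ→ℚ (n C k) ≡ 0ℚ
C-zero n<k = cong ℕ→ℚ (k>n⇒nCk≡0 n<k)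

-- Congruences modulo p

module Congruence (p : ℕ) (p-prime : Prime p) where

  P : ℚ
  P = ℕ→ℚ p

  Unit : ℤ → Set
  Unit d = ¬ (p ∣ ℤ.∣ d ∣)

  -- Null q says that q lies in p ℤ_p. The fractions num / den need not be reduced, so closure under
  -- the ring operations is immediate.
  record Zp (q : ℚ) : Set where
    constructor mkZp
    field
      den num : ℤ
      unit    : Unit den
      eq      : q · ℤ→ℚ den ≡ ℤ→ℚ num

  record Null (q : ℚ) : Set where
    constructor mkNull
    field
      den num : ℤ
      unit    : Unit den
      eq      : q · ℤ→ℚ den ≡ P · ℤ→ℚ num

  -- Denominators multiply under both ring operations, so closure of the `p`-integral numbers rests
  -- on Euclid's lemma.
  unit-* : ∀ {a b} → Unit a → Unit b → Unit (a ℤ.* b)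
  unit-* {a} {b} ua ub p∣ab with euclidsLemma ℤ.∣ a ∣ ℤ.∣ b ∣ p-prime (subst (p ∣_) (ℤ.abs-* a b) p∣ab)
  ... | inj₁ p∣a = ua p∣a
  ... | inj₂ p∣b = ub p∣b

  unit-1 : Unit (pos 1)
  unit-1 p∣1 = ℕ.nonTrivial⇒≢1 {{prime⇒nonTrivial p-prime}} (∣1⇒≡1 p∣1)

  ∣⇒multiple : ∀ a → p ∣ ℤ.∣ a ∣ → ∃[ c ] ℤ→ℚ a ≡ P · ℤ→ℚ c
  ∣⇒multiple a p∣a with ℤ.∣ᵤ⇒∣ {pos p} {a} p∣a
  ... | ℤ.divides c a≡cp = c , trans (cong ℤ→ℚ (trans a≡cp (ℤ.*-comm c (pos p)))) (ℤ→ℚ-* (pos p) c)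

  multiple⇒∣ : ∀ a c → ℤ→ℚ a ≡ P · ℤ→ℚ c → p ∣ ℤ.∣ a ∣
  multiple⇒∣ a c eq = ℤ.∣⇒∣ᵤ {pos p} {a} (ℤ.divides c
    (trans (ℤ→ℚ-injective (trans eq (sym (ℤ→ℚ-* (pos p) c)))) (ℤ.*-comm (pos p) c)))

  -- Euclid's lemma in the shape that clearing denominators produces: an equation in ℚ whose right
  -- side carries the factor `P`.
  euclid : ∀ a b c → ℤ→ℚ a · ℤ→ℚ b ≡ P · ℤ→ℚ c → p ∣ ℤ.∣ a ∣ ⊎ p ∣ ℤ.∣ b ∣
  euclid a b c eq = euclidsLemma ℤ.∣ a ∣ ℤ.∣ b ∣ p-prime
    (subst (p ∣_) (ℤ.abs-* a b) (multiple⇒∣ (a ℤ.* b) c (trans (ℤ→ℚ-* a b) eq)))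

  Zp-ℤ : ∀ a → Zp (ℤ→ℚ a)
  Zp-ℤ a = mkZp (pos 1) a unit-1 (ℚ.*-identityʳ (ℤ→ℚ a))

  Zp-ℕ : ∀ n → Zp (ℕ→ℚ n)
  Zp-ℕ n = Zp-ℤ (pos n)

  Zp-· : ∀ {a b} → Zp a → Zp b → Zp (a · b)
  Zp-· {a} {b} (mkZp d n ud eq) (mkZp e m ue eq′) = mkZp (d ℤ.* e) (n ℤ.* m) (unit-* {d} {e} ud ue) (begin
    a · b · ℤ→ℚ (d ℤ.* e)         ≡⟨ cong (a · b ·_) (ℤ→ℚ-* d e) ⟩
    a · b · (ℤ→ℚ d · ℤ→ℚ e)       ≡⟨ lemma a b (ℤ→ℚ d) (ℤ→ℚ e) ⟩
    (a · ℤ→ℚ d) · (b · ℤ→ℚ e)     ≡⟨ cong₂ _·_ eq eq′ ⟩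
    ℤ→ℚ n · ℤ→ℚ m                 ≡⟨ ℤ→ℚ-* n m ⟨
    ℤ→ℚ (n ℤ.* m)                 ∎)
    where
    open ≡-Reasoning
    lemma : ∀ a b x y → a · b · (x · y) ≡ (a · x) · (b · y)
    lemma = solve-∀ ℚ-ring

  Zp-+ : ∀ {a b} → Zp a → Zp b → Zp (a + b)
  Zp-+ {a} {b} (mkZp d n ud eq) (mkZp e m ue eq′) = mkZp (d ℤ.* e) (n ℤ.* e ℤ.+ m ℤ.* d) (unit-* {d} {e} ud ue) (begin
    (a + b) · ℤ→ℚ (d ℤ.* e)                       ≡⟨ cong ((a + b) ·_) (ℤ→ℚ-* d e) ⟩
    (a + b) · (ℤ→ℚ d · ℤ→ℚ e)                     ≡⟨ lemma a b (ℤ→ℚ d) (ℤ→ℚ e) ⟩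
    (a · ℤ→ℚ d) · ℤ→ℚ e + (b · ℤ→ℚ e) · ℤ→ℚ d     ≡⟨ cong₂ (λ x y → x · ℤ→ℚ e + y · ℤ→ℚ d) eq eq′ ⟩
    ℤ→ℚ n · ℤ→ℚ e + ℤ→ℚ m · ℤ→ℚ d                 ≡⟨ cong₂ _+_ (ℤ→ℚ-* n e) (ℤ→ℚ-* m d) ⟨
    ℤ→ℚ (n ℤ.* e) + ℤ→ℚ (m ℤ.* d)                 ≡⟨ ℤ→ℚ-+ (n ℤ.* e) (m ℤ.* d) ⟨
    ℤ→ℚ (n ℤ.* e ℤ.+ m ℤ.* d)                     ∎)
    where
    open ≡-Reasoning
    lemma : ∀ a b x y → (a + b) · (x · y) ≡ (a · x) · y + (b · y) · x
    lemma = solve-∀ ℚ-ring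

  Zp-neg : ∀ {a} → Zp a → Zp (- a)
  Zp-neg {a} za = subst Zp (lemma a) (Zp-· (Zp-ℤ (ℤ.- (pos 1))) za)
    where
    lemma : ∀ a → - 1ℚ · a ≡ - a
    lemma = solve-∀ ℚ-ring

  Zp-∸ : ∀ {a b} → Zp a → Zp b → Zp (a - b)
  Zp-∸ za zb = Zp-+ za (Zp-neg zb)

  Zp-^ : ∀ {a} n → Zp a → Zp (a ^ n)
  Zp-^ zero    za = Zp-ℕ 1
  Zp-^ (suc n) za = Zp-· za (Zp-^ n za)

  Zp-sum : ∀ n f → (∀ k → k < n → Zp (f k)) → Zp (sumQ n f)
  Zp-sum zero    f zf = Zp-ℕ 0
  Zp-sum (suc n) f zf = Zp-+ (Zp-sum n f λ k k<n → zf k (ℕ.m<n⇒m<1+n k<n)) (zf n (ℕ.n<1+n n))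

  Null-P : ∀ c → Null (P · ℤ→ℚ c)
  Null-P c = mkNull (pos 1) c unit-1 (ℚ.*-identityʳ _)

  Null-0 : Null 0ℚ
  Null-0 = subst Null (ℚ.*-zeroʳ P) (Null-P (pos 0))

  Null-+ : ∀ {a b} → Null a → Null b → Null (a + b)
  Null-+ {a} {b} (mkNull d n ud eq) (mkNull e m ue eq′) = mkNull (d ℤ.* e) (n ℤ.* e ℤ.+ m ℤ.* d) (unit-* {d} {e} ud ue) (begin
    (a + b) · ℤ→ℚ (d ℤ.* e)                              ≡⟨ cong ((a + b) ·_) (ℤ→ℚ-* d e) ⟩
    (a + b) · (ℤ→ℚ d · ℤ→ℚ e)                            ≡⟨ lemma a b (ℤ→ℚ d) (ℤ→ℚ e) ⟩
    (a · ℤ→ℚ d) · ℤ→ℚ e + (b · ℤ→ℚ e) · ℤ→ℚ d            ≡⟨ cong₂ (λ x y → x · ℤ→ℚ e + y · ℤ→ℚ d) eq eq′ ⟩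
    (P · ℤ→ℚ n) · ℤ→ℚ e + (P · ℤ→ℚ m) · ℤ→ℚ d            ≡⟨ lemma′ P (ℤ→ℚ n) (ℤ→ℚ e) (ℤ→ℚ m) (ℤ→ℚ d) ⟩
    P · (ℤ→ℚ n · ℤ→ℚ e + ℤ→ℚ m · ℤ→ℚ d)                  ≡⟨ cong (P ·_) (cong₂ _+_ (ℤ→ℚ-* n e) (ℤ→ℚ-* m d)) ⟨
    P · (ℤ→ℚ (n ℤ.* e) + ℤ→ℚ (m ℤ.* d))                  ≡⟨ cong (P ·_) (ℤ→ℚ-+ (n ℤ.* e) (m ℤ.* d)) ⟨
    P · ℤ→ℚ (n ℤ.* e ℤ.+ m ℤ.* d)                        ∎)
    where
    open ≡-Reasoning
    lemma : ∀ a b x y → (a + b) · (x · y) ≡ (a · x) · y + (b · y) · x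
    lemma = solve-∀ ℚ-ring
    lemma′ : ∀ p n e m d → (p · n) · e + (p · m) · d ≡ p · (n · e + m · d)
    lemma′ = solve-∀ ℚ-ring

  Null-· : ∀ {a b} → Zp a → Null b → Null (a · b)
  Null-· {a} {b} (mkZp d n ud eq) (mkNull e m ue eq′) = mkNull (d ℤ.* e) (n ℤ.* m) (unit-* {d} {e} ud ue) (begin
    a · b · ℤ→ℚ (d ℤ.* e)         ≡⟨ cong (a · b ·_) (ℤ→ℚ-* d e) ⟩
    a · b · (ℤ→ℚ d · ℤ→ℚ e)       ≡⟨ lemma a b (ℤ→ℚ d) (ℤ→ℚ e) ⟩
    (a · ℤ→ℚ d) · (b · ℤ→ℚ e)     ≡⟨ cong₂ _·_ eq eq′ ⟩
    ℤ→ℚ n · (P · ℤ→ℚ m)           ≡⟨ lemma′ P (ℤ→ℚ n) (ℤ→ℚ m) ⟩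
    P · (ℤ→ℚ n · ℤ→ℚ m)           ≡⟨ cong (P ·_) (ℤ→ℚ-* n m) ⟨
    P · ℤ→ℚ (n ℤ.* m)             ∎)
    where
    open ≡-Reasoning
    lemma : ∀ a b x y → a · b · (x · y) ≡ (a · x) · (b · y)
    lemma = solve-∀ ℚ-ring
    lemma′ : ∀ p n m → n · (p · m) ≡ p · (n · m)
    lemma′ = solve-∀ ℚ-ring

  -- Cross-multiplying the given fraction with the reduced one yields `↥ q · d = P · n · ↧ q`. Since
  -- `p` does not divide `d`, it divides `↥ q`.
  Null⇒∣↥ : ∀ {q} → Null q → p ∣ ℤ.∣ ↥ q ∣
  Null⇒∣↥ {q} (mkNull d n ud eq) = [ id , (λ p∣d → contradiction p∣d ud) ]′ (euclid (↥ q) d (n ℤ.* ↧ q) (begin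
    ℤ→ℚ (↥ q) · ℤ→ℚ d             ≡⟨ cong (_· ℤ→ℚ d) (q·↧q≡↥q q) ⟨
    q · ℤ→ℚ (↧ q) · ℤ→ℚ d         ≡⟨ lemma q (ℤ→ℚ (↧ q)) (ℤ→ℚ d) ⟩
    q · ℤ→ℚ d · ℤ→ℚ (↧ q)         ≡⟨ cong (_· ℤ→ℚ (↧ q)) eq ⟩
    P · ℤ→ℚ n · ℤ→ℚ (↧ q)         ≡⟨ ℚ.*-assoc P (ℤ→ℚ n) (ℤ→ℚ (↧ q)) ⟩
    P · (ℤ→ℚ n · ℤ→ℚ (↧ q))       ≡⟨ cong (P ·_) (ℤ→ℚ-* n (↧ q)) ⟨
    P · ℤ→ℚ (n ℤ.* ↧ q)           ∎))
    where
    open ≡-Reasoning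
    lemma : ∀ q a b → q · a · b ≡ q · b · a
    lemma = solve-∀ ℚ-ring

  -- Numerator and denominator of a reduced fraction are coprime. The proof of this is an irrelevant
  -- field, so it has to be recomputed before it can be applied.
  ∣↥⇒∤↧ : ∀ q → p ∣ ℤ.∣ ↥ q ∣ → ¬ (p ∣ ↧ₙ q)
  ∣↥⇒∤↧ q@(mkℚ n d-1 c) p∣↥ p∣↧ =
    ℕ.nonTrivial⇒≢1 {{prime⇒nonTrivial p-prime}} (recompute c (p∣↥ , p∣↧))

  ∣↥⇒Null : ∀ q → p ∣ ℤ.∣ ↥ q ∣ → Null q
  ∣↥⇒Null q p∣↥ with ∣⇒multiple (↥ q) p∣↥
  ... | c , eq = mkNull (↧ q) c (∣↥⇒∤↧ q p∣↥) (trans (q·↧q≡↥q q) eq)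

  InZp⇒Zp : ∀ {q} → InZp p q → Zp q
  InZp⇒Zp {q} p∤↧ = mkZp (↧ q) (↥ q) p∤↧ (q·↧q≡↥q q)

  -- The residue ring modulo `p` has no zero divisors: clear all three denominators and apply
  -- Euclid's lemma to the numerators.
  Null-split : ∀ {a b} → Zp a → Zp b → Null (a · b) → Null a ⊎ Null b
  Null-split {a} {b} (mkZp d n ud eqa) (mkZp e m ue eqb) (mkNull f l uf eq) =
    [ (λ p∣nm → Sum.map null-a null-b (euclidsLemma ℤ.∣ n ∣ ℤ.∣ m ∣ p-prime (subst (p ∣_) (ℤ.abs-* n m) p∣nm)))
    , (λ p∣f → contradiction p∣f uf) ]′
    (euclid (n ℤ.* m) f (l ℤ.* (d ℤ.* e)) (begin
      ℤ→ℚ (n ℤ.* m) · ℤ→ℚ f                ≡⟨ cong (_· ℤ→ℚ f) (ℤ→ℚ-* n m) ⟩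
      ℤ→ℚ n · ℤ→ℚ m · ℤ→ℚ f                ≡⟨ cong₂ (λ x y → x · y · ℤ→ℚ f) eqa eqb ⟨
      a · ℤ→ℚ d · (b · ℤ→ℚ e) · ℤ→ℚ f      ≡⟨ lemma a b (ℤ→ℚ d) (ℤ→ℚ e) (ℤ→ℚ f) ⟩
      a · b · ℤ→ℚ f · (ℤ→ℚ d · ℤ→ℚ e)      ≡⟨ cong₂ _·_ eq (sym (ℤ→ℚ-* d e)) ⟩
      P · ℤ→ℚ l · ℤ→ℚ (d ℤ.* e)            ≡⟨ ℚ.*-assoc P (ℤ→ℚ l) (ℤ→ℚ (d ℤ.* e)) ⟩
      P · (ℤ→ℚ l · ℤ→ℚ (d ℤ.* e))          ≡⟨ cong (P ·_) (ℤ→ℚ-* l (d ℤ.* e)) ⟨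
      P · ℤ→ℚ (l ℤ.* (d ℤ.* e))            ∎))
    where
    open ≡-Reasoning
    lemma : ∀ a b d e f → a · d · (b · e) · f ≡ a · b · f · (d · e)
    lemma = solve-∀ ℚ-ring
    null-a : p ∣ ℤ.∣ n ∣ → Null a
    null-a p∣n = let (c , n≡pc) = ∣⇒multiple n p∣n in mkNull d c ud (trans eqa n≡pc)
    null-b : p ∣ ℤ.∣ m ∣ → Null b
    null-b p∣m = let (c , m≡pc) = ∣⇒multiple m p∣m in mkNull e c ue (trans eqb m≡pc)

  Null-ℕ⇒∣ : ∀ n → Null (ℕ→ℚ n) → p ∣ n
  Null-ℕ⇒∣ n (mkNull d c ud eq) = [ id , (λ p∣d → contradiction p∣d ud) ]′ (euclid (pos n) d c eq)

  ∣⇒Null-ℕ : ∀ n → p ∣ n → Null (ℕ→ℚ n)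
  ∣⇒Null-ℕ n p∣n with ∣⇒multiple (pos n) p∣n
  ... | c , eq = subst Null (sym eq) (Null-P c)

  ≢0 : ∀ {q} → ¬ Null q → q ≢ 0ℚ
  ≢0 ¬null refl = ¬null Null-0

  -- Numerator and denominator trade places. The numerator is prime to `p`, since otherwise `q`
  -- itself would be null.
  Zp-inv : ∀ {q} → Zp q → ¬ Null q → Zp (inv q)
  Zp-inv {q} (mkZp d n ud eq) ¬null = mkZp n d un (begin
    inv q · ℤ→ℚ n          ≡⟨ cong (inv q ·_) eq ⟨
    inv q · (q · ℤ→ℚ d)    ≡⟨ lemma (inv q) q (ℤ→ℚ d) ⟩
    q · inv q · ℤ→ℚ d      ≡⟨ cong (_· ℤ→ℚ d) (q·inv (≢0 ¬null)) ⟩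
    1ℚ · ℤ→ℚ d             ≡⟨ ℚ.*-identityˡ (ℤ→ℚ d) ⟩
    ℤ→ℚ d                  ∎)
    where
    open ≡-Reasoning
    lemma : ∀ a b c → a · (b · c) ≡ b · a · c
    lemma = solve-∀ ℚ-ring
    un : Unit n
    un p∣n = let (c , n≡pc) = ∣⇒multiple n p∣n in ¬null (mkNull d c ud (trans eq n≡pc))

  infix 4 _≈_
  -- A record rather than a synonym: subtraction on ℚ computes, so unification could not recover `a`
  -- and `b` from `Null (a - b)`.
  record _≈_ (a b : ℚ) : Set where
    constructor mk≈
    field null : Null (a - b)
  open _≈_ public

  ≈-reflexive : ∀ {a b} → a ≡ b → a ≈ b
  ≈-reflexive {a} refl = mk≈ (subst Null (sym (ℚ.+-inverseʳ a)) Null-0)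

  ≈-refl : ∀ {a} → a ≈ a
  ≈-refl = ≈-reflexive refl

  ≈-sym : ∀ {a b} → a ≈ b → b ≈ a
  ≈-sym {a} {b} (mk≈ null) = mk≈ (subst Null (lemma a b) (Null-· (Zp-ℤ (ℤ.- (pos 1))) null))
    where
    lemma : ∀ a b → - 1ℚ · (a - b) ≡ b - a
    lemma = solve-∀ ℚ-ring

  ≈-trans : ∀ {a b c} → a ≈ b → b ≈ c → a ≈ c
  ≈-trans {a} {b} {c} (mk≈ n) (mk≈ m) = mk≈ (subst Null (lemma a b c) (Null-+ n m))
    where
    lemma : ∀ a b c → a - b + (b - c) ≡ a - c
    lemma = solve-∀ ℚ-ring

  ≈-+ : ∀ {a b c d} → a ≈ b → c ≈ d → a + c ≈ b + d
  ≈-+ {a} {b} {c} {d} (mk≈ n) (mk≈ m) = mk≈ (subst Null (lemma a b c d) (Null-+ n m))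
    where
    lemma : ∀ a b c d → a - b + (c - d) ≡ a + c - (b + d)
    lemma = solve-∀ ℚ-ring

  ≈-·ˡ : ∀ {a b c} → Zp c → a ≈ b → c · a ≈ c · b
  ≈-·ˡ {a} {b} {c} zc (mk≈ n) = mk≈ (subst Null (lemma a b c) (Null-· zc n))
    where
    lemma : ∀ a b c → c · (a - b) ≡ c · a - c · b
    lemma = solve-∀ ℚ-ring

  ≈-·ʳ : ∀ {a b c} → Zp c → a ≈ b → a · c ≈ b · c
  ≈-·ʳ {a} {b} {c} zc (mk≈ n) = mk≈ (subst Null (lemma a b c) (Null-· zc n))
    where
    lemma : ∀ a b c → c · (a - b) ≡ a · c - b · c
    lemma = solve-∀ ℚ-ring

  ≈-· : ∀ {a b c d} → Zp a → Zp d → a ≈ b → c ≈ d → a · c ≈ b · d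
  ≈-· za zd a≈b c≈d = ≈-trans (≈-·ˡ za c≈d) (≈-·ʳ zd a≈b)

  ≈-^ : ∀ {a b} n → Zp a → Zp b → a ≈ b → a ^ n ≈ b ^ n
  ≈-^ zero    za zb a≈b = ≈-refl
  ≈-^ (suc n) za zb a≈b = ≈-· za (Zp-^ n zb) a≈b (≈-^ n za zb a≈b)

  ≈-sum : ∀ n {f g} → (∀ k → k < n → f k ≈ g k) → sumQ n f ≈ sumQ n g
  ≈-sum zero    f≈g = ≈-refl
  ≈-sum (suc n) f≈g = ≈-+ (≈-sum n λ k k<n → f≈g k (ℕ.m<n⇒m<1+n k<n)) (f≈g n (ℕ.n<1+n n))

  Null⇒≈0 : ∀ {a} → Null a → a ≈ 0ℚ
  Null⇒≈0 {a} n = mk≈ (subst Null (sym (ℚ.+-identityʳ a)) n)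

  ≈0⇒Null : ∀ {a} → a ≈ 0ℚ → Null a
  ≈0⇒Null {a} (mk≈ n) = subst Null (ℚ.+-identityʳ a) n

  ≈-cancelˡ : ∀ {a b c} → Zp c → ¬ Null c → c · a ≈ c · b → a ≈ b
  ≈-cancelˡ {a} {b} {c} zc ¬null eq = ≈-trans (≈-reflexive (sym (lemma a))) (≈-trans (≈-·ˡ (Zp-inv zc ¬null) eq) (≈-reflexive (lemma b)))
    where
    assoc : ∀ x y z → x · (y · z) ≡ y · x · z
    assoc = solve-∀ ℚ-ring
    lemma : ∀ x → inv c · (c · x) ≡ x
    lemma x = trans (assoc (inv c) c x) (trans (cong (_· x) (q·inv (≢0 ¬null))) (ℚ.*-identityˡ x))

  ≈⇒Cong : ∀ {a b} → a ≈ b → Cong p a b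
  ≈⇒Cong (mk≈ n) = Null⇒∣↥ n

  Cong⇒≈ : ∀ {a b} → Cong p a b → a ≈ b
  Cong⇒≈ {a} {b} p∣ = mk≈ (∣↥⇒Null (a - b) p∣)

-- Binomial coefficients

n·1/n : ∀ n .{{_ : ℕ.NonZero n}} → ℕ→ℚ n · ((pos 1) ℚ./ n) ≡ 1ℚ
n·1/n n@(suc n-1) = ℚ.toℚᵘ-injective (begin
  toℚᵘ (ℕ→ℚ n · ((pos 1) ℚ./ n))                ≈⟨ ℚ.toℚᵘ-homo-* (ℕ→ℚ n) ((pos 1) ℚ./ n) ⟩
  toℚᵘ (ℕ→ℚ n) ℚᵘ.* toℚᵘ ((pos 1) ℚ./ n)        ≈⟨ ℚᵘ.*-cong (toℚᵘ-ℤ→ℚ (pos n)) (ℚ.toℚᵘ-fromℚᵘ (mkℚᵘ (pos 1) n-1)) ⟩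
  mkℚᵘ (pos n) 0 ℚᵘ.* mkℚᵘ (pos 1) n-1            ≈⟨ *≡* (cong pos (lemma n)) ⟩
  ℚᵘ.1ℚᵘ                                      ∎)
  where
  open ℚᵘ.≃-Reasoning
  lemma : ∀ n → n * 1 * 1 ≡ 1 * (1 * n)
  lemma n = trans (ℕ.*-identityʳ (n * 1)) (trans (ℕ.*-comm n 1) (sym (ℕ.*-identityˡ (1 * n))))

-- The factorial is the only denominator. Binomials with rational upper argument are compared below
-- by cancelling it and working with falling factorials.
binom-! : ∀ x k → binom x k · ℕ→ℚ (k !) ≡ falling x k
binom-! x k = begin
  falling x k · r · ℕ→ℚ (k !)     ≡⟨ lemma (falling x k) r (ℕ→ℚ (k !)) ⟩
  falling x k · (ℕ→ℚ (k !) · r)   ≡⟨ cong (falling x k ·_) (n·1/n (k !) {{k ℕ.!≢0}}) ⟩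
  falling x k · 1ℚ                ≡⟨ ℚ.*-identityʳ (falling x k) ⟩
  falling x k                     ∎
  where
  open ≡-Reasoning
  r = ((pos 1) ℚ./ (k !)) {{k ℕ.!≢0}}
  lemma : ∀ a b c → a · b · c ≡ a · (c · b)
  lemma = solve-∀ ℚ-ring

-- The recurrence of the falling factorial, proved by Pascal's rule instead of factorials. With
-- subtraction taken in ℚ no condition `k ≤ n` arises: both sides vanish for `k ≥ n`.
C-absorb : ∀ n k → ℕ→ℚ (n C suc k) · ℕ→ℚ (suc k) ≡ ℕ→ℚ (n C k) · (ℕ→ℚ n - ℕ→ℚ k)
C-absorb zero    zero    = refl
C-absorb zero    (suc k) = trans (ℚ.*-zeroˡ (ℕ→ℚ (suc (suc k)))) (sym (ℚ.*-zeroˡ (ℕ→ℚ 0 - ℕ→ℚ (suc k))))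
C-absorb (suc n) zero    = begin
  ℕ→ℚ (suc n C 1) · 1ℚ               ≡⟨ cong (_· 1ℚ) (C-suc n 0) ⟩
  (1ℚ + ℕ→ℚ (n C 1)) · 1ℚ            ≡⟨ ℚ.*-distribʳ-+ 1ℚ 1ℚ (ℕ→ℚ (n C 1)) ⟩
  1ℚ + ℕ→ℚ (n C 1) · 1ℚ              ≡⟨ cong (1ℚ +_) (C-absorb n 0) ⟩
  1ℚ + 1ℚ · (ℕ→ℚ n - 0ℚ)             ≡⟨ lemma (ℕ→ℚ n) ⟩
  1ℚ · (1ℚ + ℕ→ℚ n - 0ℚ)             ≡⟨ cong (λ x → 1ℚ · (x - 0ℚ)) (ℕ→ℚ-suc n) ⟨
  1ℚ · (ℕ→ℚ (suc n) - 0ℚ)            ∎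
  where
  open ≡-Reasoning
  lemma : ∀ a → 1ℚ + 1ℚ · (a - 0ℚ) ≡ 1ℚ · (1ℚ + a - 0ℚ)
  lemma = solve-∀ ℚ-ring
C-absorb (suc n) (suc k) = begin
  ℕ→ℚ (suc n C suc (suc k)) · ℕ→ℚ (suc (suc k))  ≡⟨ cong (_· ℕ→ℚ (suc (suc k))) (C-suc n (suc k)) ⟩
  (b + c) · ℕ→ℚ (suc (suc k))                    ≡⟨ ℚ.*-distribʳ-+ _ b c ⟩
  b · ℕ→ℚ (suc (suc k)) + c · ℕ→ℚ (suc (suc k))  ≡⟨ cong₂ (λ x y → b · x + y) (ℕ→ℚ-suc (suc k)) (C-absorb n (suc k)) ⟩
  b · (1ℚ + k′) + b · (n′ - k′)                  ≡⟨ lemma₁ b k′ n′ ⟩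
  b · k′ + b · (1ℚ + n′ - k′)                    ≡⟨ cong (_+ b · (1ℚ + n′ - k′)) (C-absorb n k) ⟩
  a · (n′ - ℕ→ℚ k) + b · (1ℚ + n′ - k′)          ≡⟨ cong (λ x → a · (n′ - ℕ→ℚ k) + b · (1ℚ + n′ - x)) (ℕ→ℚ-suc k) ⟩
  a · (n′ - ℕ→ℚ k) + b · (1ℚ + n′ - (1ℚ + ℕ→ℚ k)) ≡⟨ lemma₂ a b (ℕ→ℚ k) n′ ⟩
  (a + b) · (1ℚ + n′ - (1ℚ + ℕ→ℚ k))             ≡⟨ cong₂ (λ x y → x · (y - (1ℚ + ℕ→ℚ k))) (C-suc n k) (ℕ→ℚ-suc n) ⟨
  ℕ→ℚ (suc n C suc k) · (ℕ→ℚ (suc n) - (1ℚ + ℕ→ℚ k)) ≡⟨ cong (λ x → ℕ→ℚ (suc n C suc k) · (ℕ→ℚ (suc n) - x)) (ℕ→ℚ-suc k) ⟨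
  ℕ→ℚ (suc n C suc k) · (ℕ→ℚ (suc n) - k′)       ∎
  where
  open ≡-Reasoning
  a  = ℕ→ℚ (n C k)
  b  = ℕ→ℚ (n C suc k)
  c  = ℕ→ℚ (n C suc (suc k))
  n′ = ℕ→ℚ n
  k′ = ℕ→ℚ (suc k)
  lemma₁ : ∀ b k n → b · (1ℚ + k) + b · (n - k) ≡ b · k + b · (1ℚ + n - k)
  lemma₁ = solve-∀ ℚ-ring
  lemma₂ : ∀ a b k n → a · (n - k) + b · (1ℚ + n - (1ℚ + k)) ≡ (a + b) · (1ℚ + n - (1ℚ + k))
  lemma₂ = solve-∀ ℚ-ring

C-! : ∀ n k → ℕ→ℚ (n C k) · ℕ→ℚ (k !) ≡ falling (ℕ→ℚ n) k
C-! n zero    = refl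
C-! n (suc k) = begin
  ℕ→ℚ (n C suc k) · ℕ→ℚ (suc k !)                ≡⟨ cong (ℕ→ℚ (n C suc k) ·_) (ℕ→ℚ-* (suc k) (k !)) ⟩
  ℕ→ℚ (n C suc k) · (ℕ→ℚ (suc k) · ℕ→ℚ (k !))    ≡⟨ ℚ.*-assoc (ℕ→ℚ (n C suc k)) (ℕ→ℚ (suc k)) (ℕ→ℚ (k !)) ⟨
  ℕ→ℚ (n C suc k) · ℕ→ℚ (suc k) · ℕ→ℚ (k !)      ≡⟨ cong (_· ℕ→ℚ (k !)) (C-absorb n k) ⟩
  ℕ→ℚ (n C k) · (ℕ→ℚ n - ℕ→ℚ k) · ℕ→ℚ (k !)      ≡⟨ lemma (ℕ→ℚ (n C k)) (ℕ→ℚ n - ℕ→ℚ k) (ℕ→ℚ (k !)) ⟩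
  ℕ→ℚ (n C k) · ℕ→ℚ (k !) · (ℕ→ℚ n - ℕ→ℚ k)      ≡⟨ cong (_· (ℕ→ℚ n - ℕ→ℚ k)) (C-! n k) ⟩
  falling (ℕ→ℚ n) (suc k)                        ∎
  where
  open ≡-Reasoning
  lemma : ∀ a b c → a · b · c ≡ a · c · b
  lemma = solve-∀ ℚ-ring

!≢0ℚ : ∀ k → ℕ→ℚ (k !) ≢ 0ℚ
!≢0ℚ k = ℕ→ℚ≢0 (k !) {{k ℕ.!≢0}}

·-cancelʳ : ∀ a b {c} → c ≢ 0ℚ → a · c ≡ b · c → a ≡ b
·-cancelʳ a b {c} c≢0 eq = ·-cancelˡ c≢0 (trans (ℚ.*-comm c a) (trans eq (ℚ.*-comm b c)))

binom-ℕ : ∀ n k → binom (ℕ→ℚ n) k ≡ ℕ→ℚ (n C k)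
binom-ℕ n k = ·-cancelʳ _ _ (!≢0ℚ k) (trans (binom-! (ℕ→ℚ n) k) (sym (C-! n k)))

falling-0 : ∀ k → falling 0ℚ (suc k) ≡ 0ℚ
falling-0 zero    = refl
falling-0 (suc k) = trans (cong (_· (0ℚ - ℕ→ℚ (suc k))) (falling-0 k)) (ℚ.*-zeroˡ (0ℚ - ℕ→ℚ (suc k)))

-- Moments of a row of binomial coefficients

module _ (v : ℚ) where

  private
    w = 1ℚ + v
    term : ℕ → ℕ → ℕ → ℚ
    term n j k = ℕ→ℚ (n C k) · ℕ→ℚ (k C j) · (v ^ k)

    shifted : ℕ → ℕ → ℕ → ℚ
    shifted n j k = ℕ→ℚ (n C k) · ℕ→ℚ (suc k C j) · (v ^ k)

    -- Pascal's rule on the row `n`. The terms with `n C suc k` rejoin the head, which is the same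
    -- for `n` and `suc n`. The terms with `n C k` have their index shifted by one, which costs a
    -- factor `v`.
    step : ∀ N n j → sumQ (suc N) (term (suc n) j) ≡ sumQ (suc N) (term n j) + v · sumQ N (shifted n j)
    step N n j = begin
      sumQ (suc N) (term (suc n) j)
        ≡⟨ sumQ-head N (term (suc n) j) ⟩
      term n j 0 + sumQ N (λ k → ℕ→ℚ (suc n C suc k) · ℕ→ℚ (suc k C j) · (v ^ suc k))
        ≡⟨ cong (term n j 0 +_) (sumQ-cong N λ k _ →
             trans (cong (λ x → x · ℕ→ℚ (suc k C j) · (v ^ suc k)) (C-suc n k))
                   (lemma (ℕ→ℚ (n C k)) (ℕ→ℚ (n C suc k)) (ℕ→ℚ (suc k C j)) v (v ^ k))) ⟩
      term n j 0 + sumQ N (λ k → term n j (suc k) + v · shifted n j k)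
        ≡⟨ cong (term n j 0 +_) (sumQ-+ N (λ k → term n j (suc k)) (λ k → v · shifted n j k)) ⟩
      term n j 0 + (sumQ N (λ k → term n j (suc k)) + sumQ N (λ k → v · shifted n j k))
        ≡⟨ ℚ.+-assoc (term n j 0) (sumQ N (λ k → term n j (suc k))) (sumQ N (λ k → v · shifted n j k)) ⟨
      term n j 0 + sumQ N (λ k → term n j (suc k)) + sumQ N (λ k → v · shifted n j k)
        ≡⟨ cong₂ _+_ (sym (sumQ-head N (term n j))) (sumQ-·ˡ N v (shifted n j)) ⟩
      sumQ (suc N) (term n j) + v · sumQ N (shifted n j) ∎
      where
      open ≡-Reasoning
      lemma : ∀ a b c v x → (a + b) · c · (v · x) ≡ b · c · (v · x) + v · (a · c · x)
      lemma = solve-∀ ℚ-ring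

  -- Multiplying by `w ^ j` replaces the exponent `n - j`, so neither `j ≤ n` nor `w ≢ 0ℚ` has to be
  -- assumed. The bound `N` is free above `n` because each index shift lowers it by one.
  sum-CC : ∀ N n j → n < N → (w ^ j) · sumQ N (term n j) ≡ ℕ→ℚ (n C j) · (v ^ j) · (w ^ n)
  sum-CC (suc N) zero j _ = trans (cong ((w ^ j) ·_) (trans (sumQ-extend {1} {suc N} (term 0 j) (s≤s z≤n) vanish)
      (cong (0ℚ +_) (lemma (ℕ→ℚ (0 C j)))))) (base j)
    where
    vanish : ∀ k → 1 ≤ k → term 0 j k ≡ 0ℚ
    vanish (suc k) _ = trans (cong (_· (v ^ suc k)) (ℚ.*-zeroˡ (ℕ→ℚ (suc k C j)))) (ℚ.*-zeroˡ (v ^ suc k))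
    lemma : ∀ a → 1ℚ · a · 1ℚ ≡ a
    lemma = solve-∀ ℚ-ring
    base : ∀ j → (w ^ j) · (0ℚ + ℕ→ℚ (0 C j)) ≡ ℕ→ℚ (0 C j) · (v ^ j) · 1ℚ
    base zero    = refl
    base (suc j) = lemma′ (w ^ suc j) (v ^ suc j)
      where
      lemma′ : ∀ a b → a · (0ℚ + 0ℚ) ≡ 0ℚ · b · 1ℚ
      lemma′ = solve-∀ ℚ-ring
  -- For `j` zero the lower binomial is 1 whether shifted or not, so `shifted n 0` agrees with
  -- `term n 0` by computation.
  sum-CC (suc N) (suc n) zero (s≤s n<N) = begin
    1ℚ · sumQ (suc N) (term (suc n) 0)                            ≡⟨ cong (1ℚ ·_) (step N n 0) ⟩
    1ℚ · (sumQ (suc N) (term n 0) + v · sumQ N (term n 0))        ≡⟨ lemma₁ (sumQ (suc N) (term n 0)) (sumQ N (term n 0)) v ⟩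
    1ℚ · sumQ (suc N) (term n 0) + v · (1ℚ · sumQ N (term n 0))   ≡⟨ cong₂ (λ x y → x + v · y) (sum-CC (suc N) n 0 (ℕ.m<n⇒m<1+n n<N)) (sum-CC N n 0 n<N) ⟩
    1ℚ · 1ℚ · (w ^ n) + v · (1ℚ · 1ℚ · (w ^ n))                   ≡⟨ lemma₂ v (w ^ n) ⟩
    1ℚ · 1ℚ · (w · (w ^ n))                                       ∎
    where
    open ≡-Reasoning
    lemma₁ : ∀ a b v → 1ℚ · (a + v · b) ≡ 1ℚ · a + v · (1ℚ · b)
    lemma₁ = solve-∀ ℚ-ring
    lemma₂ : ∀ v x → 1ℚ · 1ℚ · x + v · (1ℚ · 1ℚ · x) ≡ 1ℚ · 1ℚ · ((1ℚ + v) · x)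
    lemma₂ = solve-∀ ℚ-ring
  sum-CC (suc N) (suc n) (suc j) (s≤s n<N) = begin
    (w · (w ^ j)) · sumQ (suc N) (term (suc n) (suc j))
      ≡⟨ cong ((w · (w ^ j)) ·_) (trans (step N n (suc j)) (cong (λ x → A + v · x) split)) ⟩
    (w · (w ^ j)) · (A + v · (B + D))
      ≡⟨ lemma₁ w (w ^ j) A B D v ⟩
    (w · (w ^ j)) · A + v · (w · ((w ^ j) · B) + (w · (w ^ j)) · D)
      ≡⟨ cong₂ (λ x y → x + v · (w · y + (w · (w ^ j)) · D)) (sum-CC (suc N) n (suc j) (ℕ.m<n⇒m<1+n n<N)) (sum-CC N n j n<N) ⟩
    c₁ · (v · (v ^ j)) · (w ^ n) + v · (w · (c₀ · (v ^ j) · (w ^ n)) + (w · (w ^ j)) · D)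
      ≡⟨ cong (λ x → c₁ · (v · (v ^ j)) · (w ^ n) + v · (w · (c₀ · (v ^ j) · (w ^ n)) + x)) (sum-CC N n (suc j) n<N) ⟩
    c₁ · (v · (v ^ j)) · (w ^ n) + v · (w · (c₀ · (v ^ j) · (w ^ n)) + c₁ · (v · (v ^ j)) · (w ^ n))
      ≡⟨ lemma₂ c₀ c₁ v (v ^ j) (w ^ n) ⟩
    (c₀ + c₁) · (v · (v ^ j)) · (w · (w ^ n))
      ≡⟨ cong (λ x → x · (v · (v ^ j)) · (w · (w ^ n))) (C-suc n j) ⟨
    ℕ→ℚ (suc n C suc j) · (v · (v ^ j)) · (w · (w ^ n)) ∎
    where
    open ≡-Reasoning
    A = sumQ (suc N) (term n (suc j))
    B = sumQ N (term n j)
    D = sumQ N (term n (suc j))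
    c₀ = ℕ→ℚ (n C j)
    c₁ = ℕ→ℚ (n C suc j)
    distrib : ∀ a b c x → a · (b + c) · x ≡ a · b · x + a · c · x
    distrib = solve-∀ ℚ-ring
    -- Pascal's rule a second time, now for the lower binomial `suc k C suc j`.
    split : sumQ N (shifted n (suc j)) ≡ B + D
    split = trans (sumQ-cong N λ k _ → trans (cong (λ x → ℕ→ℚ (n C k) · x · (v ^ k)) (C-suc k j))
                                             (distrib (ℕ→ℚ (n C k)) (ℕ→ℚ (k C j)) (ℕ→ℚ (k C suc j)) (v ^ k)))
                  (sumQ-+ N (term n j) (term n (suc j)))
    lemma₁ : ∀ w x a b d v → (w · x) · (a + v · (b + d)) ≡ (w · x) · a + v · (w · (x · b) + (w · x) · d)
    lemma₁ = solve-∀ ℚ-ring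
    lemma₂ : ∀ c₀ c₁ v x y → c₁ · (v · x) · y + v · ((1ℚ + v) · (c₀ · x · y) + c₁ · (v · x) · y)
                           ≡ (c₀ + c₁) · (v · x) · ((1ℚ + v) · y)
    lemma₂ = solve-∀ ℚ-ring

-- Factorials and central binomial coefficients

C-+-! : ∀ a b → ((a ℕ.+ b) C a) * (a ! * b !) ≡ (a ℕ.+ b) !
C-+-! a b = begin
  ((a ℕ.+ b) C a) * (a ! * b !)                                 ≡⟨ cong (λ c → ((a ℕ.+ b) C a) * (a ! * c !)) (ℕ.m+n∸m≡n a b) ⟨
  ((a ℕ.+ b) C a) * (a ! * (a ℕ.+ b ℕ.∸ a) !)                   ≡⟨ cong (_* (a ! * (a ℕ.+ b ℕ.∸ a) !)) (nCk≡n!/k![n-k]! (ℕ.m≤m+n a b)) ⟩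
  ((a ℕ.+ b) ! ℕ./ (a ! * (a ℕ.+ b ℕ.∸ a) !)) * (a ! * (a ℕ.+ b ℕ.∸ a) !) ≡⟨ m/n*n≡m (k![n∸k]!∣n! (ℕ.m≤m+n a b)) ⟩
  (a ℕ.+ b) !                                                   ∎
  where
  open ≡-Reasoning
  instance _ = a ℕ.!* (a ℕ.+ b ℕ.∸ a) !≢0

C-+-!ℚ : ∀ a b → ℕ→ℚ ((a ℕ.+ b) C a) · (ℕ→ℚ (a !) · ℕ→ℚ (b !)) ≡ ℕ→ℚ ((a ℕ.+ b) !)
C-+-!ℚ a b = begin
  ℕ→ℚ ((a ℕ.+ b) C a) · (ℕ→ℚ (a !) · ℕ→ℚ (b !))   ≡⟨ cong (ℕ→ℚ ((a ℕ.+ b) C a) ·_) (ℕ→ℚ-* (a !) (b !)) ⟨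
  ℕ→ℚ ((a ℕ.+ b) C a) · ℕ→ℚ (a ! * b !)           ≡⟨ ℕ→ℚ-* ((a ℕ.+ b) C a) (a ! * b !) ⟨
  ℕ→ℚ (((a ℕ.+ b) C a) * (a ! * b !))             ≡⟨ cong ℕ→ℚ (C-+-! a b) ⟩
  ℕ→ℚ ((a ℕ.+ b) !)                               ∎
  where open ≡-Reasoning

-- The quotient `(x + r)! / x!`. For a literal `r` it unfolds to `r` linear factors, which is how
-- the polynomial identities below spell it out.
rising : ℚ → ℕ → ℚ
rising x zero    = 1ℚ
rising x (suc r) = (x + ℕ→ℚ (suc r)) · rising x r

+-!ℚ : ∀ r a → ℕ→ℚ ((r ℕ.+ a) !) ≡ rising (ℕ→ℚ a) r · ℕ→ℚ (a !)
+-!ℚ zero    a = sym (ℚ.*-identityˡ (ℕ→ℚ (a !)))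
+-!ℚ (suc r) a = begin
  ℕ→ℚ (suc (r ℕ.+ a) * (r ℕ.+ a) !)                   ≡⟨ ℕ→ℚ-* (suc (r ℕ.+ a)) ((r ℕ.+ a) !) ⟩
  ℕ→ℚ (suc r ℕ.+ a) · ℕ→ℚ ((r ℕ.+ a) !)               ≡⟨ cong₂ _·_ (trans (cong ℕ→ℚ (ℕ.+-comm (suc r) a)) (ℕ→ℚ-+ a (suc r))) (+-!ℚ r a) ⟩
  (ℕ→ℚ a + ℕ→ℚ (suc r)) · (rising (ℕ→ℚ a) r · ℕ→ℚ (a !)) ≡⟨ ℚ.*-assoc (ℕ→ℚ a + ℕ→ℚ (suc r)) (rising (ℕ→ℚ a) r) (ℕ→ℚ (a !)) ⟨
  rising (ℕ→ℚ a) (suc r) · ℕ→ℚ (a !)                  ∎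
  where open ≡-Reasoning

*-suc-! : ∀ r k → ℕ→ℚ ((r * suc k) !) ≡ rising (ℕ→ℚ r · ℕ→ℚ k) r · ℕ→ℚ ((r * k) !)
*-suc-! r k = begin
  ℕ→ℚ ((r * suc k) !)                                 ≡⟨ cong (λ n → ℕ→ℚ (n !)) (ℕ.*-suc r k) ⟩
  ℕ→ℚ ((r ℕ.+ r * k) !)                               ≡⟨ +-!ℚ r (r * k) ⟩
  rising (ℕ→ℚ (r * k)) r · ℕ→ℚ ((r * k) !)            ≡⟨ cong (λ x → rising x r · ℕ→ℚ ((r * k) !)) (ℕ→ℚ-* r k) ⟩
  rising (ℕ→ℚ r · ℕ→ℚ k) r · ℕ→ℚ ((r * k) !)          ∎
  where open ≡-Reasoning

suc-! : ∀ k → ℕ→ℚ (suc k !) ≡ (ℕ→ℚ k + 1ℚ) · ℕ→ℚ (k !)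
suc-! k = trans (ℕ→ℚ-* (suc k) (k !)) (cong (_· ℕ→ℚ (k !)) (trans (ℕ→ℚ-suc k) (ℚ.+-comm 1ℚ (ℕ→ℚ k))))

-4ℚ : ℚ
-4ℚ = - ℕ→ℚ 4

-- Both sides are 1 at `k = 0` and grow by the same ratio: `-4 (-½ - k)(k + 1) = (2k + 1)(2k + 2)`.
falling-½ : ∀ k → falling -½ k · (-4ℚ ^ k) · ℕ→ℚ (k !) ≡ ℕ→ℚ ((2 * k) !)
falling-½ zero    = refl
falling-½ (suc k) = begin
  falling -½ (suc k) · (-4ℚ ^ suc k) · ℕ→ℚ (suc k !)
    ≡⟨ cong (falling -½ (suc k) · (-4ℚ ^ suc k) ·_) (suc-! k) ⟩
  falling -½ k · (-½ - ℕ→ℚ k) · (-4ℚ · (-4ℚ ^ k)) · ((ℕ→ℚ k + 1ℚ) · ℕ→ℚ (k !))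
    ≡⟨ lemma (falling -½ k) (-4ℚ ^ k) (ℕ→ℚ (k !)) (ℕ→ℚ k) ⟩
  (ℕ→ℚ 2 · ℕ→ℚ k + ℕ→ℚ 2) · ((ℕ→ℚ 2 · ℕ→ℚ k + ℕ→ℚ 1) · 1ℚ) · (falling -½ k · (-4ℚ ^ k) · ℕ→ℚ (k !))
    ≡⟨ cong (rising (ℕ→ℚ 2 · ℕ→ℚ k) 2 ·_) (falling-½ k) ⟩
  rising (ℕ→ℚ 2 · ℕ→ℚ k) 2 · ℕ→ℚ ((2 * k) !)
    ≡⟨ *-suc-! 2 k ⟨
  ℕ→ℚ ((2 * suc k) !) ∎
  where
  open ≡-Reasoning
  lemma : ∀ f e x K → f · (-½ - K) · (- ℕ→ℚ 4 · e) · ((K + 1ℚ) · x)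
    ≡ (ℕ→ℚ 2 · K + ℕ→ℚ 2) · ((ℕ→ℚ 2 · K + ℕ→ℚ 1) · 1ℚ) · (f · e · x)
  lemma = solve-∀ ℚ-ring

C-2k-k : ∀ k → ℕ→ℚ ((2 * k) C k) · (ℕ→ℚ (k !) · ℕ→ℚ (k !)) ≡ ℕ→ℚ ((2 * k) !)
C-2k-k k = trans (cong (λ n → ℕ→ℚ (n C k) · (ℕ→ℚ (k !) · ℕ→ℚ (k !))) 2k≡k+k)
  (trans (C-+-!ℚ k k) (cong (λ n → ℕ→ℚ (n !)) (sym 2k≡k+k)))
  where
  2k≡k+k : 2 * k ≡ k ℕ.+ k
  2k≡k+k = cong (k ℕ.+_) (ℕ.+-identityʳ k)

-- An exact identity in ℚ. A congruence enters only later, when `-½` is replaced by an integer.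
binom-½ : ∀ k → binom -½ k · (-4ℚ ^ k) ≡ ℕ→ℚ ((2 * k) C k)
binom-½ k = ·-cancelʳ _ _ (≢0-· (!≢0ℚ k) (!≢0ℚ k)) (begin
  binom -½ k · e · (k! · k!)       ≡⟨ lemma (binom -½ k) e k! ⟩
  (binom -½ k · k!) · e · k!       ≡⟨ cong (λ x → x · e · k!) (binom-! -½ k) ⟩
  falling -½ k · e · k!            ≡⟨ falling-½ k ⟩
  ℕ→ℚ ((2 * k) !)                  ≡⟨ C-2k-k k ⟨
  ℕ→ℚ ((2 * k) C k) · (k! · k!)    ∎)
  where
  open ≡-Reasoning
  k! = ℕ→ℚ (k !)
  e  = -4ℚ ^ k
  lemma : ∀ b e x → b · e · (x · x) ≡ (b · x) · e · x
  lemma = solve-∀ ℚ-ring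

0^ : ∀ {n} → 0 < n → 0ℚ ^ n ≡ 0ℚ
0^ {suc n} _ = ℚ.*-zeroˡ (0ℚ ^ n)

-- Fermat's little theorem

module Binomials (p : ℕ) (p-prime : Prime p) where
  open Congruence p p-prime

  1<p : 1 < p
  1<p = ℕ.nonTrivial⇒n>1 p {{prime⇒nonTrivial p-prime}}

  ∤! : ∀ k → k < p → ¬ (p ∣ k !)
  ∤! zero    _   = unit-1
  ∤! (suc k) k<p p∣ = [ (λ p∣k → ℕ.<⇒≱ k<p (∣⇒≤ p∣k)) , ∤! k (ℕ.<-trans (ℕ.n<1+n k) k<p) ]′ (euclidsLemma (suc k) (k !) p-prime p∣)

  Zp-falling : ∀ {x} k → Zp x → Zp (falling x k)
  Zp-falling zero    zx = Zp-ℕ 1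
  Zp-falling (suc k) zx = Zp-· (Zp-falling k zx) (Zp-∸ zx (Zp-ℕ k))

  Zp-1/! : ∀ {k} → k < p → Zp (((pos 1) ℚ./ (k !)) {{k ℕ.!≢0}})
  Zp-1/! {k} k<p = mkZp (pos (k !)) (pos 1) (∤! k k<p)
    (trans (ℚ.*-comm (((pos 1) ℚ./ (k !)) {{k ℕ.!≢0}}) (ℕ→ℚ (k !))) (n·1/n (k !) {{k ℕ.!≢0}}))

  -- The denominator `k !` is prime to `p` only for `k < p`. This is why the bound on the index
  -- accompanies every use of `binom` modulo `p`.
  Zp-binom : ∀ {x k} → k < p → Zp x → Zp (binom x k)
  Zp-binom {x} {k} k<p zx = Zp-· (Zp-falling k zx) (Zp-1/! k<p)

  falling-≈ : ∀ {x y} k → Zp x → Zp y → x ≈ y → falling x k ≈ falling y k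
  falling-≈ zero    zx zy x≈y = ≈-refl
  falling-≈ (suc k) zx zy x≈y = ≈-· (Zp-falling k zx) (Zp-∸ zy (Zp-ℕ k)) (falling-≈ k zx zy x≈y) (≈-+ x≈y ≈-refl)

  binom-≈ : ∀ {x y k} → k < p → Zp x → Zp y → x ≈ y → binom x k ≈ binom y k
  binom-≈ {k = k} k<p zx zy x≈y = ≈-·ʳ (Zp-1/! k<p) (falling-≈ k zx zy x≈y)

  P≈0 : P ≈ 0ℚ
  P≈0 = Null⇒≈0 (subst Null (ℚ.*-identityʳ P) (Null-P (pos 1)))

  -- For an index below `p` the binomial depends on its upper argument only modulo `p`, so `p` may
  -- be replaced by 0, and `binom 0ℚ (suc k)` vanishes.
  C-p≈0 : ∀ {k} → suc k < p → ℕ→ℚ (p C suc k) ≈ 0ℚ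
  C-p≈0 {k} k<p = ≈-trans (≈-reflexive (sym (binom-ℕ p (suc k))))
    (≈-trans (binom-≈ k<p (Zp-ℕ p) (Zp-ℕ 0) P≈0)
      (≈-reflexive (trans (cong (_· ((pos 1) ℚ./ (suc k !)) {{suc k ℕ.!≢0}}) (falling-0 k)) (ℚ.*-zeroˡ (((pos 1) ℚ./ (suc k !)) {{suc k ℕ.!≢0}})))))

  sum≈head : ∀ n f → 0 < n → (∀ k → 0 < k → k < n → f k ≈ 0ℚ) → sumQ n f ≈ f 0
  sum≈head (suc zero)    f _ f≈0 = ≈-reflexive (ℚ.+-identityˡ (f 0))
  sum≈head (suc (suc n)) f _ f≈0 = ≈-trans
    (≈-+ (sum≈head (suc n) f z<s λ k 0<k k<n → f≈0 k 0<k (ℕ.m<n⇒m<1+n k<n)) (f≈0 (suc n) z<s (ℕ.n<1+n (suc n))))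
    (≈-reflexive (ℚ.+-identityʳ (f 0)))

  0<p : 0 < p
  0<p = ℕ.<-trans z<s 1<p

  -- The binomial theorem is the case `j = 0` of `sum-CC`; modulo `p` only the two end terms
  -- survive.
  freshman : ∀ {v} → Zp v → (1ℚ + v) ^ p ≈ 1ℚ + (v ^ p)
  freshman {v} zv = ≈-trans (≈-reflexive (sym expand)) (≈-+ inner (≈-reflexive last))
    where
    term : ℕ → ℚ
    term k = ℕ→ℚ (p C k) · ℕ→ℚ (k C 0) · (v ^ k)
    1·1· : ∀ x → 1ℚ · 1ℚ · x ≡ x
    1·1· = solve-∀ ℚ-ring
    expand : sumQ (suc p) term ≡ (1ℚ + v) ^ p
    expand = trans (sym (ℚ.*-identityˡ (sumQ (suc p) term))) (trans (sum-CC v (suc p) p 0 (ℕ.n<1+n p)) (1·1· ((1ℚ + v) ^ p)))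
    last : term p ≡ v ^ p
    last = trans (cong (λ n → ℕ→ℚ n · 1ℚ · (v ^ p)) (nCn≡1 p)) (1·1· (v ^ p))
    0· : ∀ a b → 0ℚ · a · b ≡ 0ℚ
    0· = solve-∀ ℚ-ring
    vanish : ∀ k → 0 < k → k < p → term k ≈ 0ℚ
    vanish (suc k) _ k<p = ≈-trans (≈-·ʳ (Zp-^ (suc k) zv) (≈-·ʳ (Zp-ℕ 1) (C-p≈0 k<p)))
      (≈-reflexive (0· 1ℚ (v ^ suc k)))
    inner : sumQ p term ≈ 1ℚ
    inner = sum≈head p term 0<p vanish

  fermat-ℕ : ∀ n → ℕ→ℚ n ^ p ≈ ℕ→ℚ n
  fermat-ℕ zero    = ≈-reflexive (0^ 0<p)
  fermat-ℕ (suc n) = ≈-trans (≈-reflexive (cong (_^ p) (ℕ→ℚ-suc n)))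
    (≈-trans (freshman (Zp-ℕ n)) (≈-trans (≈-+ (≈-refl {1ℚ}) (fermat-ℕ n)) (≈-reflexive (sym (ℕ→ℚ-suc n)))))

  ℤ≈ℕ : ∀ a → ∃[ n ] ℤ→ℚ a ≈ ℕ→ℚ n
  ℤ≈ℕ (pos n) = n , ≈-refl
  -- Minus `suc n` is congruent to `(p - 1) * suc n`, and the difference of the two is exactly `p`
  -- times `a`.
  ℤ≈ℕ a@(-[1+ n ]) = n′ * suc n , mk≈ (subst Null eq (Null-P a))
    where
    n′ = ℕ.pred p
    p≡ : P ≡ 1ℚ + ℕ→ℚ n′
    p≡ = trans (cong ℕ→ℚ (sym (ℕ.suc-pred p {{prime⇒nonZero p-prime}}))) (ℕ→ℚ-suc n′)
    a≡ : ℤ→ℚ a ≡ - ℕ→ℚ (suc n)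
    a≡ = trans (cong ℤ→ℚ (sym (ℤ.-1*i≡-i (pos (suc n))))) (trans (ℤ→ℚ-* -[1+ 0 ] (pos (suc n))) (lemma₀ (ℕ→ℚ (suc n))))
      where
      lemma₀ : ∀ x → - 1ℚ · x ≡ - x
      lemma₀ = solve-∀ ℚ-ring
    eq : P · ℤ→ℚ a ≡ ℤ→ℚ a - ℕ→ℚ (n′ * suc n)
    eq = begin
      P · ℤ→ℚ a                                   ≡⟨ cong₂ _·_ p≡ a≡ ⟩
      (1ℚ + ℕ→ℚ n′) · (- ℕ→ℚ (suc n))             ≡⟨ lemma (ℕ→ℚ n′) (ℕ→ℚ (suc n)) ⟩
      - ℕ→ℚ (suc n) - ℕ→ℚ n′ · ℕ→ℚ (suc n)        ≡⟨ cong₂ _-_ a≡ (ℕ→ℚ-* n′ (suc n)) ⟨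
      ℤ→ℚ a - ℕ→ℚ (n′ * suc n)                    ∎
      where
      open ≡-Reasoning
      lemma : ∀ a b → (1ℚ + a) · (- b) ≡ - b - a · b
      lemma = solve-∀ ℚ-ring

  fermat-ℤ : ∀ a → ℤ→ℚ a ^ p ≈ ℤ→ℚ a
  fermat-ℤ a = let (n , a≈n) = ℤ≈ℕ a in
    ≈-trans (≈-^ p (Zp-ℤ a) (Zp-ℕ n) a≈n) (≈-trans (fermat-ℕ n) (≈-sym a≈n))

  Unit⇒¬Null : ∀ d → Unit d → ¬ Null (ℤ→ℚ d)
  Unit⇒¬Null d ud (mkNull e c ue eq) = [ ud , ue ]′ (euclid d e c eq)

  -- Clear the denominator, `d q = a`. Then `d q^p ≡ d^p q^p = a^p ≡ a = d q` by the integer case,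
  -- and `d` cancels.
  fermat : ∀ {q} → Zp q → q ^ p ≈ q
  fermat {q} zq@(mkZp d a ud eq) = ≈-cancelˡ (Zp-ℤ d) (Unit⇒¬Null d ud)
    (≈-trans (≈-·ʳ (Zp-^ p zq) (≈-sym (fermat-ℤ d)))
      (≈-trans (≈-reflexive (trans (sym (^-distribʳ-· (ℤ→ℚ d) q p)) (cong (_^ p) dq≡a)))
        (≈-trans (fermat-ℤ a) (≈-reflexive (sym dq≡a)))))
    where
    dq≡a : ℤ→ℚ d · q ≡ ℤ→ℚ a
    dq≡a = trans (ℚ.*-comm (ℤ→ℚ d) q) eq

-- Euler's criterion

-- A vector c₀ ∷ … ∷ c_{d-1} ∷ [] stands for the monic polynomial c₀ + … + c_{d-1} x^{d-1} + x^d.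
eval : ∀ {d} → Vec ℚ d → ℚ → ℚ
eval []       x = 1ℚ
eval (c ∷ cs) x = c + x · eval cs x

-- Synthetic division by `x - r`: the partial values of Horner's scheme at `r` are the coefficients
-- of the quotient. The leading coefficient stays 1, so the encoding of monic polynomials is
-- preserved.
quotient : ∀ {d} → ℚ → Vec ℚ (suc d) → Vec ℚ d
quotient r (c ∷ [])         = []
quotient r (c ∷ cs@(_ ∷ _)) = eval cs r ∷ quotient r cs

eval-quotient : ∀ {d} (f : Vec ℚ (suc d)) r x → eval f x - eval f r ≡ (x - r) · eval (quotient r f) x
eval-quotient (c ∷ []) r x = lemma c r x
  where
  lemma : ∀ c r x → c + x · 1ℚ - (c + r · 1ℚ) ≡ (x - r) · 1ℚ
  lemma = solve-∀ ℚ-ring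
eval-quotient (c ∷ cs@(_ ∷ _)) r x = begin
  c + x · eval cs x - (c + r · eval cs r)                       ≡⟨ lemma₁ c r x (eval cs x) (eval cs r) ⟩
  x · (eval cs x - eval cs r) + (x - r) · eval cs r             ≡⟨ cong (λ y → x · y + (x - r) · eval cs r) (eval-quotient cs r x) ⟩
  x · ((x - r) · eval (quotient r cs) x) + (x - r) · eval cs r  ≡⟨ lemma₂ r x (eval (quotient r cs) x) (eval cs r) ⟩
  (x - r) · (eval cs r + x · eval (quotient r cs) x)            ∎
  where
  open ≡-Reasoning
  lemma₁ : ∀ c r x g h → c + x · g - (c + r · h) ≡ x · (g - h) + (x - r) · h
  lemma₁ = solve-∀ ℚ-ring
  lemma₂ : ∀ r x q h → x · ((x - r) · q) + (x - r) · h ≡ (x - r) · (h + x · q)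
  lemma₂ = solve-∀ ℚ-ring

eval-replicate : ∀ n x → eval (replicate n 0ℚ) x ≡ x ^ n
eval-replicate zero    x = refl
eval-replicate (suc n) x = trans (ℚ.+-identityˡ (x · eval (replicate n 0ℚ) x)) (cong (x ·_) (eval-replicate n x))

-- Roots of polynomials modulo p

module Lagrange (p : ℕ) (p-prime : Prime p) where
  open Congruence p p-prime

  Zp-eval : ∀ {d} {f : Vec ℚ d} {x} → All Zp f → Zp x → Zp (eval f x)
  Zp-eval []         zx = Zp-ℕ 1
  Zp-eval (zc ∷ zcs) zx = Zp-+ zc (Zp-· zx (Zp-eval zcs zx))

  Zp-quotient : ∀ {d} {f : Vec ℚ (suc d)} {r} → All Zp f → Zp r → All Zp (quotient r f)
  Zp-quotient (_ ∷ [])             zr = []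
  Zp-quotient (_ ∷ zcs@(_ ∷ _))    zr = Zp-eval zcs zr ∷ Zp-quotient zcs zr

  roots-of-quotient : ∀ {d} {f : Vec ℚ (suc d)} {r x} → All Zp f → Zp r → Zp x →
    Null (eval f r) → Null (eval f x) → x ≈ r ⊎ Null (eval (quotient r f) x)
  roots-of-quotient {f = f} {r} {x} zf zr zx root-r root-x =
    Sum.map₁ mk≈ (Null-split (Zp-∸ zx zr) (Zp-eval (Zp-quotient zf zr) zx)
      (subst Null (eval-quotient f r x)
        (null (≈-trans (Null⇒≈0 root-x) (≈-sym (Null⇒≈0 root-r))))))

  ¬Null-1 : ¬ Null 1ℚ
  ¬Null-1 n = unit-1 (Null-ℕ⇒∣ 1 n)

  -- Lagrange's theorem in positive form: instead of counting roots it names the known root that `x`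
  -- is congruent to. Dividing by the last root leaves the others as roots of the quotient, and in
  -- degree 0 the polynomial is 1, which has no root.
  root-among : ∀ d (f : Vec ℚ d) (r : ℕ → ℚ) → All Zp f → (∀ i → Zp (r i)) →
    (∀ i j → i < j → j < d → ¬ (r i ≈ r j)) → (∀ i → i < d → Null (eval f (r i))) →
    ∀ x → Zp x → Null (eval f x) → ∃[ i ] i < d × x ≈ r i
  root-among zero    [] r zf zr distinct roots x zx root = contradiction root ¬Null-1
  root-among (suc d) f  r zf zr distinct roots x zx root = [ here , there ]′ (roots-of-quotient zf (zr d) zx root-d root)
    where
    root-d : Null (eval f (r d))
    root-d = roots d (ℕ.n<1+n d)
    quotient-roots : ∀ i → i < d → Null (eval (quotient (r d) f) (r i))
    quotient-roots i i<d = [ (λ r≈r → contradiction r≈r (distinct i d i<d (ℕ.n<1+n d))) , id ]′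
      (roots-of-quotient zf (zr d) (zr i) root-d (roots i (ℕ.m<n⇒m<1+n i<d)))
    here : x ≈ r d → ∃[ i ] i < suc d × x ≈ r i
    here x≈r = d , ℕ.n<1+n d , x≈r
    there : Null (eval (quotient (r d) f) x) → ∃[ i ] i < suc d × x ≈ r i
    there root′ = map₂ (map₁ ℕ.m<n⇒m<1+n) (root-among d (quotient (r d) f) r (Zp-quotient zf (zr d)) zr
      (λ i j i<j j<d → distinct i j i<j (ℕ.m<n⇒m<1+n j<d)) quotient-roots x zx root′)

  Zp-replicate-0 : ∀ n → All Zp (replicate n 0ℚ)
  Zp-replicate-0 zero    = []
  Zp-replicate-0 (suc n) = Zp-ℕ 0 ∷ Zp-replicate-0 n

  power-root-among : ∀ {n} (r : ℕ → ℚ) → 0 < n → (∀ i → Zp (r i)) →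
    (∀ i j → i < j → j < n → ¬ (r i ≈ r j)) → (∀ i → i < n → r i ^ n ≈ 1ℚ) →
    ∀ x → Zp x → x ^ n ≈ 1ℚ → ∃[ i ] i < n × x ≈ r i
  power-root-among {suc n} r _ zr distinct roots x zx root =
    root-among (suc n) f r (Zp-ℤ -[1+ 0 ] ∷ Zp-replicate-0 n) zr distinct (λ i i<n → ≈1⇒root (r i) (roots i i<n)) x zx (≈1⇒root x root)
    where
    -- The polynomial `x^(n+1) - 1`, its leading term being implicit.
    f : Vec ℚ (suc n)
    f = - 1ℚ ∷ replicate n 0ℚ
    ≈1⇒root : ∀ x → x ^ suc n ≈ 1ℚ → Null (eval f x)
    ≈1⇒root x (mk≈ eq) = subst Null (trans (ℚ.+-comm (x ^ suc n) (- 1ℚ)) (cong (λ y → - 1ℚ + x · y) (sym (eval-replicate n x)))) eq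

-- Half powers and quadratic residues

module Odd (p : ℕ) (p-prime : Prime p) (n : ℕ) (p≡1+2n : p ≡ suc (2 * n)) where
  open Congruence p p-prime
  open Binomials p p-prime
  open Lagrange p p-prime

  2n<p : 2 * n < p
  2n<p = ℕ.≤-reflexive (sym p≡1+2n)

  0<n : 0 < n
  0<n = ℕ.n≢0⇒n>0 λ n≡0 → ℕ.<-irrefl (sym (trans p≡1+2n (cong (λ k → suc (2 * k)) n≡0))) 1<p

  ¬Null-ℕ : ∀ k → 0 < k → k < p → ¬ Null (ℕ→ℚ k)
  ¬Null-ℕ k 0<k k<p null-k = ℕ.<⇒≱ k<p (∣⇒≤ {{ℕ.>-nonZero 0<k}} (Null-ℕ⇒∣ k null-k))

  2<p : 2 < p
  2<p = ℕ.≤-<-trans (ℕ.*-monoʳ-≤ 2 0<n) 2n<p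

  Zp--½ : Zp -½
  Zp--½ = mkZp (pos 2) -[1+ 0 ] (λ p∣2 → ¬Null-ℕ 2 z<s 2<p (∣⇒Null-ℕ 2 p∣2)) refl

  -- Twice the difference is `-(1 + 2n) = -p`, whence the denominator 2 and the numerator -1.
  -½≈n : -½ ≈ ℕ→ℚ n
  -½≈n = mk≈ (mkNull (pos 2) -[1+ 0 ] (λ p∣2 → ¬Null-ℕ 2 z<s 2<p (∣⇒Null-ℕ 2 p∣2)) (begin
    (-½ - ℕ→ℚ n) · ℕ→ℚ 2         ≡⟨ lemma (ℕ→ℚ n) ⟩
    (1ℚ + ℕ→ℚ 2 · ℕ→ℚ n) · - 1ℚ  ≡⟨ cong (λ x → (1ℚ + x) · - 1ℚ) (ℕ→ℚ-* 2 n) ⟨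
    (1ℚ + ℕ→ℚ (2 * n)) · - 1ℚ    ≡⟨ cong (_· - 1ℚ) (trans (cong ℕ→ℚ p≡1+2n) (ℕ→ℚ-suc (2 * n))) ⟨
    P · - 1ℚ                     ∎))
    where
    open ≡-Reasoning
    lemma : ∀ a → (-½ - a) · ℕ→ℚ 2 ≡ (1ℚ + ℕ→ℚ 2 · a) · - 1ℚ
    lemma = solve-∀ ℚ-ring

  Zp--4 : Zp -4ℚ
  Zp--4 = Zp-neg (Zp-ℕ 4)

  central≈ : ∀ k → k < p → ℕ→ℚ ((2 * k) C k) ≈ ℕ→ℚ (n C k) · (-4ℚ ^ k)
  central≈ k k<p = ≈-trans (≈-reflexive (sym (binom-½ k)))
    (≈-·ʳ (Zp-^ k Zp--4) (≈-trans (binom-≈ k<p Zp--½ (Zp-ℕ n) -½≈n) (≈-reflexive (binom-ℕ n k))))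

  -- Multiplied by `a` the left side becomes `a ^ p`, so Fermat's theorem applies and `a` cancels.
  half-power² : ∀ {a} → Zp a → ¬ Null a → (a ^ n) · (a ^ n) ≈ 1ℚ
  half-power² {a} za ¬null = ≈-cancelˡ za ¬null
    (≈-trans (≈-reflexive a^p) (≈-trans (fermat za) (≈-reflexive (sym (ℚ.*-identityʳ a)))))
    where
    a^p : a · ((a ^ n) · (a ^ n)) ≡ a ^ p
    a^p = trans (cong (a ·_) (trans (sym (^-distribˡ-+ a n n)) (cong (λ k → a ^ (n ℕ.+ k)) (sym (ℕ.+-identityʳ n)))))
                (cong (a ^_) (sym p≡1+2n))

  square : ℕ → ℚ
  square y = ℕ→ℚ y · ℕ→ℚ y

  square-power : ∀ y → ¬ Null (ℕ→ℚ y) → square y ^ n ≈ 1ℚ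
  square-power y ¬null = ≈-trans (≈-reflexive (^-distribʳ-· (ℕ→ℚ y) (ℕ→ℚ y) n)) (half-power² (Zp-ℕ y) ¬null)

  -- The difference of the squares factors as `suc e` times `s`, the difference and the sum of the
  -- two bases. Both lie between 1 and `2n`, so neither is divisible by `p`.
  squares-distinct : ∀ i j → i < j → j < n → ¬ (square (suc i) ≈ square (suc j))
  squares-distinct i j i<j j<n eq = [ ¬Null-ℕ (suc e) z<s e<p , ¬Null-ℕ s z<s s<p ]′
    (Null-split (Zp-ℕ (suc e)) (Zp-ℕ s) (subst Null factor (null (≈-sym eq))))
    where
    e = j ℕ.∸ suc i
    s = suc j ℕ.+ suc i
    j≡ : suc j ≡ suc e ℕ.+ suc i
    j≡ = cong suc (sym (ℕ.m∸n+n≡m i<j))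
    s<p : s < p
    s<p = ℕ.≤-<-trans (ℕ.+-mono-≤ j<n (ℕ.≤-trans (ℕ.≤-trans i<j (ℕ.<⇒≤ j<n)) (ℕ.≤-reflexive (sym (ℕ.+-identityʳ n))))) 2n<p
    e<p : suc e < p
    e<p = ℕ.≤-<-trans (ℕ.≤-trans (ℕ.m≤m+n (suc e) (suc i)) (ℕ.≤-trans (ℕ.≤-reflexive (sym j≡)) (ℕ.m≤m+n (suc j) (suc i)))) s<p
    sucj : ℕ→ℚ (suc j) ≡ ℕ→ℚ (suc e) + ℕ→ℚ (suc i)
    sucj = trans (cong ℕ→ℚ j≡) (ℕ→ℚ-+ (suc e) (suc i))
    lemma : ∀ a b → (a + b) · (a + b) - b · b ≡ a · (a + b + b)
    lemma = solve-∀ ℚ-ring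
    open ≡-Reasoning
    factor : square (suc j) - square (suc i) ≡ ℕ→ℚ (suc e) · ℕ→ℚ s
    factor = begin
      square (suc j) - square (suc i)                              ≡⟨ cong (λ x → x · x - square (suc i)) sucj ⟩
      (ℕ→ℚ (suc e) + ℕ→ℚ (suc i)) · (ℕ→ℚ (suc e) + ℕ→ℚ (suc i)) - square (suc i)
                                                                   ≡⟨ lemma (ℕ→ℚ (suc e)) (ℕ→ℚ (suc i)) ⟩
      ℕ→ℚ (suc e) · (ℕ→ℚ (suc e) + ℕ→ℚ (suc i) + ℕ→ℚ (suc i))      ≡⟨ cong (λ x → ℕ→ℚ (suc e) · (x + ℕ→ℚ (suc i))) sucj ⟨
      ℕ→ℚ (suc e) · (ℕ→ℚ (suc j) + ℕ→ℚ (suc i))                    ≡⟨ cong (ℕ→ℚ (suc e) ·_) (ℕ→ℚ-+ (suc j) (suc i)) ⟨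
      ℕ→ℚ (suc e) · ℕ→ℚ s                                          ∎

  n<p : n < p
  n<p = ℕ.≤-<-trans (ℕ.m≤m+n n (n ℕ.+ 0)) 2n<p

  -- The squares of `1, ..., n` are `n` incongruent roots of `x^n - 1`, so by Lagrange's theorem `a`
  -- must be one of them. No primitive root is involved.
  half-power-one⇒square : ∀ {a} → Zp a → a ^ n ≈ 1ℚ → ∃[ y ] y < p × square y ≈ a
  half-power-one⇒square {a} za a^n≈1 = conclude (power-root-among (λ i → square (suc i)) 0<n
    (λ i → Zp-· (Zp-ℕ (suc i)) (Zp-ℕ (suc i))) squares-distinct
    (λ i i<n → square-power (suc i) (¬Null-ℕ (suc i) z<s (ℕ.≤-<-trans i<n n<p))) a za a^n≈1)
    where
    conclude : (∃[ i ] i < n × a ≈ square (suc i)) → ∃[ y ] y < p × square y ≈ a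
    conclude (i , i<n , a≈) = suc i , ℕ.≤-<-trans i<n n<p , ≈-sym a≈

  -- The search range of `legendre` contains `y = 0`; that `a` is not null excludes this case.
  square-half-power : ∀ {a} y → Zp a → ¬ Null a → square y ≈ a → a ^ n ≈ 1ℚ
  square-half-power {a} y za ¬null y²≈a =
    ≈-trans (≈-^ n za (Zp-· (Zp-ℕ y) (Zp-ℕ y)) (≈-sym y²≈a)) (square-power y ¬null-y)
    where
    ¬null-y : ¬ Null (ℕ→ℚ y)
    ¬null-y null-y = ¬null (≈0⇒Null (≈-trans (≈-sym y²≈a) (Null⇒≈0 (Null-· (Zp-ℕ y) null-y))))

  half-power-≉1 : ∀ {a} → Zp a → ¬ Null a → ¬ (a ^ n ≈ 1ℚ) → a ^ n ≈ - 1ℚ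
  half-power-≉1 {a} za ¬null a^n≉1 = [ (λ n → contradiction (mk≈ n) a^n≉1) , mk≈ ]′
      (Null-split {(a ^ n) - 1ℚ} {(a ^ n) + 1ℚ} (Zp-∸ (Zp-^ n za) (Zp-ℕ 1)) (Zp-+ (Zp-^ n za) (Zp-ℕ 1))
        (subst Null (lemma (a ^ n)) (null (half-power² za ¬null))))
    where
    lemma : ∀ x → x · x - 1ℚ ≡ (x - 1ℚ) · (x + 1ℚ)
    lemma = solve-∀ ℚ-ring

  euler : ∀ {a} → Zp a → ¬ Null a → ℤ→ℚ (legendre p a) ≈ a ^ n
  euler {a} za ¬null = cases _ _ refl refl
    where
    is-root : ℕ → Bool
    is-root y = cong? p (ℕ→ℚ y · ℕ→ℚ y) a
    -- Abstracting the two tests lets the conditional in `legendre` reduce, while the equations keep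
    -- the evidence that each outcome carries.
    cases : ∀ b c → cong? p a 0ℚ ≡ b → any is-root (upTo p) ≡ c →
      ℤ→ℚ (if b then pos 0 else if c then pos 1 else -[1+ 0 ]) ≈ a ^ n
    cases true  _     a≟0 _ = contradiction (≈0⇒Null (Cong⇒≈ {a} {0ℚ} (toWitness (subst T (sym a≟0) tt)))) ¬null
    cases false true  _ residue = residue-case (find (any⁻ is-root (upTo p) (subst T (sym residue) tt)))
      where
      residue-case : (∃[ y ] y ∈ upTo p × T (is-root y)) → 1ℚ ≈ a ^ n
      residue-case (y , _ , root) = ≈-sym (square-half-power y za ¬null (Cong⇒≈ {square y} {a} (toWitness root)))
    cases false false _ nonresidue = ≈-sym (half-power-≉1 za ¬null λ a^n≈1 → no-root (half-power-one⇒square za a^n≈1))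
      where
      no-root : ¬ (∃[ y ] y < p × square y ≈ a)
      no-root (y , y<p , y²≈a) =
        subst T nonresidue (any⁺ is-root (lose (∈-upTo⁺ y<p) (fromWitness (≈⇒Cong y²≈a))))

-- The two transformations

sum-G : ∀ N (w : ℕ → ℚ) x → sumQ N (λ k → w k · G k x) ≡
  sumQ N (λ j → (binom x j · binom (- 1ℚ - x) j) · (((- 1ℚ) ^ j) · sumQ N (λ k → w k · ℕ→ℚ (k C j))))
sum-G N w x = begin
  sumQ N (λ k → w k · G k x)
    -- Since `k C j` vanishes for `j > k`, the inner sum may run up to `N` for every `k`; with
    -- bounds independent of each other the two sums can be interchanged.
    ≡⟨ sumQ-cong N (λ k k<N → trans (cong (w k ·_) (sym (sumQ-extend (term k) k<N (vanish k)))) (sym (sumQ-·ˡ N (w k) (term k)))) ⟩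
  sumQ N (λ k → sumQ N (λ j → w k · term k j))
    ≡⟨ sumQ-swap N N (λ k j → w k · term k j) ⟩
  sumQ N (λ j → sumQ N (λ k → w k · term k j))
    ≡⟨ sumQ-cong N (λ j _ → trans
         (sumQ-cong N (λ k _ → lemma₁ (w k) (ℕ→ℚ (k C j)) ((- 1ℚ) ^ j) (binom x j) (binom (- 1ℚ - x) j)))
         (trans (sumQ-·ˡ N (binom x j · binom (- 1ℚ - x) j · ((- 1ℚ) ^ j)) (λ k → w k · ℕ→ℚ (k C j)))
                (ℚ.*-assoc (binom x j · binom (- 1ℚ - x) j) ((- 1ℚ) ^ j) (sumQ N (λ k → w k · ℕ→ℚ (k C j)))))) ⟩
  sumQ N (λ j → (binom x j · binom (- 1ℚ - x) j) · (((- 1ℚ) ^ j) · sumQ N (λ k → w k · ℕ→ℚ (k C j)))) ∎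
  where
  open ≡-Reasoning
  term : ℕ → ℕ → ℚ
  term k j = ℕ→ℚ (k C j) · ((- 1ℚ) ^ j) · binom x j · binom (- 1ℚ - x) j
  0··· : ∀ a b c → 0ℚ · a · b · c ≡ 0ℚ
  0··· = solve-∀ ℚ-ring
  vanish : ∀ k j → k < j → term k j ≡ 0ℚ
  vanish k j k<j = trans (cong (λ c → c · ((- 1ℚ) ^ j) · binom x j · binom (- 1ℚ - x) j) (C-zero k<j))
    (0··· ((- 1ℚ) ^ j) (binom x j) (binom (- 1ℚ - x) j))
  lemma₁ : ∀ w c s a b → w · (c · s · a · b) ≡ (a · b · s) · (w · c)
  lemma₁ = solve-∀ ℚ-ring

geometric : ∀ t N → (1ℚ - t) · sumQ N (λ k → (t ^ k) · ℕ→ℚ (k C 0)) ≡ 1ℚ - (t ^ N)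
geometric t zero    = ℚ.*-zeroʳ (1ℚ - t)
geometric t (suc N) = trans (ℚ.*-distribˡ-+ (1ℚ - t) (sumQ N (λ k → (t ^ k) · ℕ→ℚ (k C 0))) ((t ^ N) · 1ℚ))
  (trans (cong (_+ (1ℚ - t) · ((t ^ N) · 1ℚ)) (geometric t N)) (lemma t (t ^ N)))
  where
  lemma : ∀ t x → 1ℚ - x + (1ℚ - t) · (x · 1ℚ) ≡ 1ℚ - t · x
  lemma = solve-∀ ℚ-ring

-- Pascal's rule lowers the order of the moment from `suc j` to `j` at the price of one boundary
-- term. At `N = p` that term is a multiple of `p C suc j`, hence null for `suc j < p`.
geometric-C : ∀ t j N → (1ℚ - t) · sumQ N (λ k → (t ^ k) · ℕ→ℚ (k C suc j))
  ≡ t · sumQ N (λ k → (t ^ k) · ℕ→ℚ (k C j)) - ℕ→ℚ (N C suc j) · (t ^ N)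
geometric-C t j zero = lemma t
  where
  lemma : ∀ t → (1ℚ - t) · 0ℚ ≡ t · 0ℚ - 0ℚ · 1ℚ
  lemma = solve-∀ ℚ-ring
geometric-C t j (suc N) = begin
  (1ℚ - t) · (A + (t ^ N) · c₁)                        ≡⟨ ℚ.*-distribˡ-+ (1ℚ - t) A ((t ^ N) · c₁) ⟩
  (1ℚ - t) · A + (1ℚ - t) · ((t ^ N) · c₁)             ≡⟨ cong (_+ (1ℚ - t) · ((t ^ N) · c₁)) (geometric-C t j N) ⟩
  t · B - c₁ · (t ^ N) + (1ℚ - t) · ((t ^ N) · c₁)     ≡⟨ lemma t B c₀ c₁ (t ^ N) ⟩
  t · (B + (t ^ N) · c₀) - (c₀ + c₁) · (t · (t ^ N))   ≡⟨ cong (λ c → t · (B + (t ^ N) · c₀) - c · (t · (t ^ N))) (C-suc N j) ⟨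
  t · (B + (t ^ N) · c₀) - ℕ→ℚ (suc N C suc j) · (t · (t ^ N)) ∎
  where
  open ≡-Reasoning
  A  = sumQ N (λ k → (t ^ k) · ℕ→ℚ (k C suc j))
  B  = sumQ N (λ k → (t ^ k) · ℕ→ℚ (k C j))
  c₀ = ℕ→ℚ (N C j)
  c₁ = ℕ→ℚ (N C suc j)
  lemma : ∀ t b c₀ c₁ x → t · b - c₁ · x + (1ℚ - t) · (x · c₁) ≡ t · (b + x · c₀) - (c₀ + c₁) · (t · x)
  lemma = solve-∀ ℚ-ring

inv-scale : ∀ {a c} k → a ≢ 0ℚ → c ≢ 0ℚ → inv ((a · inv c) ^ k) ≡ (c ^ k) · inv (a ^ k)
inv-scale {a} {c} k a≢0 c≢0 = inv≡ ((a · inv c) ^ k) ((c ^ k) · inv (a ^ k)) (begin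
  ((a · inv c) ^ k) · ((c ^ k) · inv (a ^ k))        ≡⟨ cong₂ (λ x y → x · ((c ^ k) · y)) (^-distribʳ-· a (inv c) k) (inv-^ a k a≢0) ⟩
  (a ^ k) · (inv c ^ k) · ((c ^ k) · (inv a ^ k))    ≡⟨ lemma (a ^ k) (inv c ^ k) (c ^ k) (inv a ^ k) ⟩
  (a ^ k) · (inv a ^ k) · ((c ^ k) · (inv c ^ k))    ≡⟨ cong₂ _·_ (^-inverse a (inv a) k (q·inv a≢0)) (^-inverse c (inv c) k (q·inv c≢0)) ⟩
  1ℚ                                                 ∎)
  where
  open ≡-Reasoning
  lemma : ∀ a b c d → a · b · (c · d) ≡ a · d · (c · b)
  lemma = solve-∀ ℚ-ring

module Transform (p : ℕ) (p-prime : Prime p) (n : ℕ) (p≡1+2n : p ≡ suc (2 * n)) where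
  open Congruence p p-prime
  open Binomials p p-prime
  open Odd p p-prime n p≡1+2n

  Zp--1-x : ∀ {x} → Zp x → Zp (- 1ℚ - x)
  Zp--1-x = Zp-∸ (Zp-ℤ -[1+ 0 ])

  Zp-a : ∀ {x j} → j < p → Zp x → Zp (binom x j · binom (- 1ℚ - x) j)
  Zp-a j<p zx = Zp-· (Zp-binom j<p zx) (Zp-binom j<p (Zp--1-x zx))

  transform : ∀ (w y : ℕ → ℚ) x → Zp x →
    (∀ j → j < p → ((- 1ℚ) ^ j) · sumQ p (λ k → w k · ℕ→ℚ (k C j)) ≈ y j) →
    sumQ p (λ k → w k · G k x) ≈ sumQ p (λ j → (binom x j · binom (- 1ℚ - x) j) · y j)
  transform w y x zx moments = ≈-trans (≈-reflexive (sum-G p w x))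
    (≈-sum p λ j j<p → ≈-·ˡ (Zp-a j<p zx) (moments j j<p))

  Null-neg : ∀ {a} → Null a → Null (- a)
  Null-neg {a} na = subst Null (lemma a) (Null-· (Zp-ℤ -[1+ 0 ]) na)
    where
    lemma : ∀ a → - 1ℚ · a ≡ - a
    lemma = solve-∀ ℚ-ring

  sum-G/m^k : ∀ m x → Zp m → Zp x → ¬ Null m → ¬ Null (1ℚ - m) →
    sumQ p (λ k → G k x · inv (m ^ k)) ≈ sumQ p (λ k → binom x k · binom (- 1ℚ - x) k · inv ((1ℚ - m) ^ k))
  sum-G/m^k m x zm zx m≉0 m≉1 = ≈-trans
    (≈-reflexive (sumQ-cong p λ k _ → trans (cong (G k x ·_) (inv-^ m k (≢0 m≉0))) (ℚ.*-comm (G k x) (t ^ k))))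
    (≈-trans (transform (t ^_) (s ^_) x zx moments)
      (≈-reflexive (sumQ-cong p λ k _ → cong (binom x k · binom (- 1ℚ - x) k ·_) (sym (inv-^ (1ℚ - m) k (≢0 m≉1))))))
    where
    t = inv m
    s = inv (1ℚ - m)
    S : ℕ → ℚ
    S j = sumQ p (λ k → (t ^ k) · ℕ→ℚ (k C j))
    zt : Zp t
    zt = Zp-inv zm m≉0
    mt≡1 : m · t ≡ 1ℚ
    mt≡1 = q·inv (≢0 m≉0)
    z[1-t] : Zp (1ℚ - t)
    z[1-t] = Zp-∸ (Zp-ℕ 1) zt
    1-t≉0 : ¬ Null (1ℚ - t)
    1-t≉0 null-1-t = m≉1 (subst Null (trans (lemma m t) (cong (_- m) mt≡1)) (Null-· (Zp-neg zm) null-1-t))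
      where
      lemma : ∀ m t → (- m) · (1ℚ - t) ≡ m · t - m
      lemma = solve-∀ ℚ-ring
    -- With `t = 1/m` this says `-t/(1 - t) = 1/(1 - m)`. The sign `(-1)^j` coming from `G` is thus
    -- absorbed and the moments become plain powers of `s`.
    [1-t]s : (1ℚ - t) · s ≡ - t
    [1-t]s = begin
      (1ℚ - t) · s              ≡⟨ cong (λ x → (x - t) · s) mt≡1 ⟨
      (m · t - t) · s           ≡⟨ lemma m t s ⟩
      - (t · ((1ℚ - m) · s))    ≡⟨ cong (λ x → - (t · x)) (q·inv (≢0 m≉1)) ⟩
      - (t · 1ℚ)                ≡⟨ cong -_ (ℚ.*-identityʳ t) ⟩
      - t                       ∎
      where
      open ≡-Reasoning
      lemma : ∀ m t s → (m · t - t) · s ≡ - (t · ((1ℚ - m) · s))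
      lemma = solve-∀ ℚ-ring
    ≈-neg : ∀ {a b} → a ≈ b → - a ≈ - b
    ≈-neg {a} {b} (mk≈ n) = mk≈ (subst Null (lemma a b) (Null-neg n))
      where
      lemma : ∀ a b → - (a - b) ≡ - a - (- b)
      lemma = solve-∀ ℚ-ring
    moments : ∀ j → j < p → ((- 1ℚ) ^ j) · S j ≈ s ^ j
    -- The boundary term is `t ^ p`, which Fermat's theorem turns into `t`; both sides then equal
    -- `1ℚ - t`, so `S 0` is congruent to 1.
    moments zero    _   = ≈-trans (≈-reflexive (ℚ.*-identityˡ (S 0))) (≈-cancelˡ z[1-t] 1-t≉0
      (≈-trans (≈-reflexive (geometric t p)) (≈-trans (≈-+ (≈-refl {1ℚ}) (≈-neg (fermat zt)))
        (≈-reflexive (sym (ℚ.*-identityʳ (1ℚ - t)))))))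
    moments (suc j) j<p = ≈-cancelˡ z[1-t] 1-t≉0 (≈-trans (≈-reflexive expand)
      (≈-trans (≈-+ (≈-·ˡ (Zp-neg zt) (moments j (ℕ.<-trans (ℕ.n<1+n j) j<p)))
                    (≈-·ˡ (Zp-^ j (Zp-ℤ -[1+ 0 ])) (≈-·ʳ (Zp-^ p zt) (C-p≈0 j<p))))
        (≈-reflexive collapse)))
      where
      open ≡-Reasoning
      σ = (- 1ℚ) ^ j
      c = ℕ→ℚ (p C suc j)
      lemma₁ : ∀ t σ x → (1ℚ - t) · (- 1ℚ · σ · x) ≡ - σ · ((1ℚ - t) · x)
      lemma₁ = solve-∀ ℚ-ring
      lemma₂ : ∀ t σ x c y → - σ · (t · x - c · y) ≡ - t · (σ · x) + σ · (c · y)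
      lemma₂ = solve-∀ ℚ-ring
      lemma₃ : ∀ t σ x y → - t · y + σ · (0ℚ · x) ≡ - t · y
      lemma₃ = solve-∀ ℚ-ring
      expand : (1ℚ - t) · (((- 1ℚ) ^ suc j) · S (suc j)) ≡ - t · (σ · S j) + σ · (c · (t ^ p))
      expand = begin
        (1ℚ - t) · (((- 1ℚ) ^ suc j) · S (suc j))   ≡⟨ lemma₁ t σ (S (suc j)) ⟩
        - σ · ((1ℚ - t) · S (suc j))                ≡⟨ cong (- σ ·_) (geometric-C t j p) ⟩
        - σ · (t · S j - c · (t ^ p))               ≡⟨ lemma₂ t σ (S j) c (t ^ p) ⟩
        - t · (σ · S j) + σ · (c · (t ^ p))         ∎
      collapse : - t · (s ^ j) + σ · (0ℚ · (t ^ p)) ≡ (1ℚ - t) · (s ^ suc j)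
      collapse = begin
        - t · (s ^ j) + σ · (0ℚ · (t ^ p))          ≡⟨ lemma₃ t σ (t ^ p) (s ^ j) ⟩
        - t · (s ^ j)                               ≡⟨ cong (_· (s ^ j)) [1-t]s ⟨
        (1ℚ - t) · s · (s ^ j)                      ≡⟨ ℚ.*-assoc (1ℚ - t) s (s ^ j) ⟩
        (1ℚ - t) · (s ^ suc j)                      ∎

  -- The half power of a unit is its own inverse modulo `p`. This turns the half power of the
  -- quotient `D/A` into that of the product `A · D`, the argument of the Legendre symbol.
  inverse-half-power : ∀ {a b} → Zp a → ¬ Null a → a · b ≡ 1ℚ → b ^ n ≈ a ^ n
  inverse-half-power {a} {b} za a≉0 ab≡1 = ≈-cancelˡ (Zp-^ n za) a^n≉0
    (≈-trans (≈-reflexive (^-inverse a b n ab≡1)) (≈-sym (half-power² za a≉0)))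
    where
    a^n≉0 : ¬ Null (a ^ n)
    a^n≉0 null-a^n = Lagrange.¬Null-1 p p-prime
      (subst Null (trans (ℚ.*-comm (b ^ n) (a ^ n)) (^-inverse a b n ab≡1)) (Null-· (Zp-^ n zb) null-a^n))
      where
      zb : Zp b
      zb = subst Zp (inv≡ a b ab≡1) (Zp-inv za a≉0)

  c : ℕ → ℚ
  c k = ℕ→ℚ ((2 * k) C k)

  -- The parameters `m + 2` and `m - 2` matter only through their difference, since `1 - 4/A = D/A`.
  -- Keeping `A` and `D` free lets the same statement serve the rescaled parameters `m/N` and
  -- `(m - L)/N`.
  sum-cG/A^k : ∀ A D x → Zp A → Zp x → A - D ≡ ℕ→ℚ 4 → ¬ Null A → ¬ Null D →
    sumQ p (λ k → c k · G k x · inv (A ^ k)) ≈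
    ((A · D) ^ n) · sumQ p (λ k → c k · binom x k · binom (- 1ℚ - x) k · inv ((- D) ^ k))
  sum-cG/A^k A D x zA zx A-D≡4 A≉0 D≉0 = ≈-trans
    (≈-reflexive (sumQ-cong p λ k _ → trans (cong (c k · G k x ·_) (inv-^ A k (≢0 A≉0))) (lemma₀ (c k) (G k x) (u ^ k))))
    (≈-trans (transform (λ k → c k · (u ^ k)) (λ j → ε · (c j · (s ^ j))) x zx moments)
      (≈-reflexive (trans (sumQ-cong p λ k _ → trans (lemma₁ (binom x k) (binom (- 1ℚ - x) k) ε (c k) (s ^ k))
                                                     (cong (λ y → ε · (c k · binom x k · binom (- 1ℚ - x) k · y)) (sym (inv-^ (- D) k (≢0 -D≉0)))))
                          (sumQ-·ˡ p ε (λ k → c k · binom x k · binom (- 1ℚ - x) k · inv ((- D) ^ k))))))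
    where
    -- In fractions: `v = -4/A`, `w = D/A`, `z = A/D = 1/w` and `s = -1/D`, so that
    -- `-zv = 4/D = -4s`.
    u = inv A
    s = inv (- D)
    v = -4ℚ · u
    w = 1ℚ + v
    z = - (s · A)
    ε = (A · D) ^ n
    lemma₀ : ∀ c g u → c · g · u ≡ c · u · g
    lemma₀ = solve-∀ ℚ-ring
    lemma₁ : ∀ a b e c s → (a · b) · (e · (c · s)) ≡ e · (c · a · b · s)
    lemma₁ = solve-∀ ℚ-ring
    -D≉0 : ¬ Null (- D)
    -D≉0 null-D = D≉0 (subst Null (lemma D) (Null-neg null-D))
      where
      lemma : ∀ d → - - d ≡ d
      lemma = solve-∀ ℚ-ring
    zD : Zp D
    zD = subst Zp (trans (cong (λ y → A - y) (sym A-D≡4)) (lemma A D)) (Zp-∸ zA (Zp-ℕ 4))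
      where
      lemma : ∀ a d → a - (a - d) ≡ d
      lemma = solve-∀ ℚ-ring
    zu : Zp u
    zu = Zp-inv zA A≉0
    zs : Zp s
    zs = Zp-inv (Zp-neg zD) -D≉0
    Au≡1 : A · u ≡ 1ℚ
    Au≡1 = q·inv (≢0 A≉0)
    open ≡-Reasoning
    w≡Du : w ≡ D · u
    w≡Du = begin
      1ℚ + (- ℕ→ℚ 4) · u         ≡⟨ cong₂ (λ x y → x + (- y) · u) Au≡1 A-D≡4 ⟨
      A · u + (- (A - D)) · u    ≡⟨ lemma A D u ⟩
      D · u                      ∎
      where
      lemma : ∀ a d u → a · u + (- (a - d)) · u ≡ d · u
      lemma = solve-∀ ℚ-ring
    zw≡1 : z · w ≡ 1ℚ
    zw≡1 = begin
      - (s · A) · w              ≡⟨ cong (z ·_) w≡Du ⟩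
      - (s · A) · (D · u)        ≡⟨ lemma s A D u ⟩
      (- D) · s · (A · u)        ≡⟨ cong₂ _·_ (q·inv (≢0 -D≉0)) Au≡1 ⟩
      1ℚ                         ∎
      where
      lemma : ∀ s a d u → - (s · a) · (d · u) ≡ (- d) · s · (a · u)
      lemma = solve-∀ ℚ-ring
    -zv≡-4s : - 1ℚ · (z · v) ≡ -4ℚ · s
    -zv≡-4s = begin
      - 1ℚ · (- (s · A) · (-4ℚ · u))   ≡⟨ lemma s A -4ℚ u ⟩
      -4ℚ · s · (A · u)                ≡⟨ cong (-4ℚ · s ·_) Au≡1 ⟩
      -4ℚ · s · 1ℚ                     ≡⟨ ℚ.*-identityʳ (-4ℚ · s) ⟩
      -4ℚ · s                          ∎
      where
      lemma : ∀ s a f u → - 1ℚ · (- (s · a) · (f · u)) ≡ f · s · (a · u)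
      lemma = solve-∀ ℚ-ring
    w^n≈ε : w ^ n ≈ ε
    w^n≈ε = ≈-trans (≈-reflexive (trans (cong (_^ n) w≡Du) (^-distribʳ-· D u n)))
      (≈-trans (≈-·ˡ (Zp-^ n zD) (inverse-half-power zA A≉0 Au≡1))
        (≈-reflexive (trans (ℚ.*-comm (D ^ n) (A ^ n)) (sym (^-distribʳ-· A D n)))))
    term : ℕ → ℕ → ℚ
    term j k = ℕ→ℚ (n C k) · ℕ→ℚ (k C j) · (v ^ k)
    term≈ : ∀ j k → k < p → c k · (u ^ k) · ℕ→ℚ (k C j) ≈ term j k
    term≈ j k k<p = ≈-trans (≈-·ʳ (Zp-ℕ (k C j)) (≈-·ʳ (Zp-^ k zu) (central≈ k k<p)))
      (≈-reflexive (trans (lemma (ℕ→ℚ (n C k)) (-4ℚ ^ k) (u ^ k) (ℕ→ℚ (k C j)))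
                          (cong (ℕ→ℚ (n C k) · ℕ→ℚ (k C j) ·_) (sym (^-distribʳ-· -4ℚ u k)))))
      where
      lemma : ∀ a f u b → a · f · u · b ≡ a · b · (f · u)
      lemma = solve-∀ ℚ-ring
    -- Inserting `(z ^ j) · (w ^ j)`, which is 1, supplies the factor `w ^ j` that `sum-CC` needs.
    -- The leftover `(-1)^j z^j v^j` is `(-4s)^j`.
    closed-form : ∀ j → ((- 1ℚ) ^ j) · sumQ p (term j) ≡ ℕ→ℚ (n C j) · (-4ℚ ^ j) · ((s ^ j) · (w ^ n))
    closed-form j = begin
      σ · M                                              ≡⟨ cong (σ ·_) (ℚ.*-identityˡ M) ⟨
      σ · (1ℚ · M)                                       ≡⟨ cong (λ x → σ · (x · M)) (^-inverse z w j zw≡1) ⟨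
      σ · ((z ^ j) · (w ^ j) · M)                        ≡⟨ cong (σ ·_) (ℚ.*-assoc (z ^ j) (w ^ j) M) ⟩
      σ · ((z ^ j) · ((w ^ j) · M))                      ≡⟨ cong (λ x → σ · ((z ^ j) · x)) (sum-CC v p n j n<p) ⟩
      σ · ((z ^ j) · (ℕ→ℚ (n C j) · (v ^ j) · (w ^ n)))  ≡⟨ lemma σ (z ^ j) (ℕ→ℚ (n C j)) (v ^ j) (w ^ n) ⟩
      ℕ→ℚ (n C j) · (σ · ((z ^ j) · (v ^ j))) · (w ^ n)  ≡⟨ cong (λ x → ℕ→ℚ (n C j) · x · (w ^ n)) powers ⟩
      ℕ→ℚ (n C j) · ((-4ℚ ^ j) · (s ^ j)) · (w ^ n)      ≡⟨ lemma′ (ℕ→ℚ (n C j)) (-4ℚ ^ j) (s ^ j) (w ^ n) ⟩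
      ℕ→ℚ (n C j) · (-4ℚ ^ j) · ((s ^ j) · (w ^ n))      ∎
      where
      σ = (- 1ℚ) ^ j
      M = sumQ p (term j)
      lemma : ∀ σ z a v w → σ · (z · (a · v · w)) ≡ a · (σ · (z · v)) · w
      lemma = solve-∀ ℚ-ring
      lemma′ : ∀ a f s w → a · (f · s) · w ≡ a · f · (s · w)
      lemma′ = solve-∀ ℚ-ring
      powers : σ · ((z ^ j) · (v ^ j)) ≡ (-4ℚ ^ j) · (s ^ j)
      powers = begin
        σ · ((z ^ j) · (v ^ j))     ≡⟨ cong (σ ·_) (^-distribʳ-· z v j) ⟨
        σ · ((z · v) ^ j)           ≡⟨ ^-distribʳ-· (- 1ℚ) (z · v) j ⟨
        (- 1ℚ · (z · v)) ^ j        ≡⟨ cong (_^ j) -zv≡-4s ⟩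
        (-4ℚ · s) ^ j               ≡⟨ ^-distribʳ-· -4ℚ s j ⟩
        (-4ℚ ^ j) · (s ^ j)         ∎
    moments : ∀ j → j < p → ((- 1ℚ) ^ j) · sumQ p (λ k → c k · (u ^ k) · ℕ→ℚ (k C j)) ≈ ε · (c j · (s ^ j))
    moments j j<p = ≈-trans (≈-·ˡ (Zp-^ j (Zp-ℤ -[1+ 0 ])) (≈-sum p (term≈ j)))
      (≈-trans (≈-reflexive (closed-form j))
        -- `central≈` is now read backwards: `C(n,j) (-4)^j` restores the central binomial `c j` on
        -- the right-hand side.
        (≈-trans (≈-·ʳ (Zp-· (Zp-^ j zs) (Zp-^ n (subst Zp (sym w≡Du) (Zp-· zD zu)))) (≈-sym (central≈ j j<p)))
          (≈-trans (≈-reflexive (sym (ℚ.*-assoc (c j) (s ^ j) (w ^ n))))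
            (≈-trans (≈-·ˡ (Zp-· (Zp-ℕ ((2 * j) C j)) (Zp-^ j zs)) w^n≈ε)
              (≈-reflexive (ℚ.*-comm (c j · (s ^ j)) ε))))))

-- Products of integer binomials

-⅓ -¼ -⅙ : ℚ
-⅓ = - ((pos 1) ℚ./ 3)
-¼ = - ((pos 1) ℚ./ 4)
-⅙ = - ((pos 1) ℚ./ 6)

falling² : ℚ → ℚ → ℕ → ℚ
falling² x N k = falling x k · falling (- 1ℚ - x) k · (N ^ k)

falling²-suc : ∀ x N k → falling² x N (suc k) ≡ N · (x - ℕ→ℚ k) · (- 1ℚ - x - ℕ→ℚ k) · falling² x N k
falling²-suc x N k = lemma (falling x k) (falling (- 1ℚ - x) k) (x - ℕ→ℚ k) (- 1ℚ - x - ℕ→ℚ k) N (N ^ k)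
  where
  lemma : ∀ f g a b N e → (f · a) · (g · b) · (N · e) ≡ N · a · b · (f · g · e)
  lemma = solve-∀ ℚ-ring

binom²-! : ∀ x N k → binom x k · binom (- 1ℚ - x) k · (N ^ k) · (ℕ→ℚ (k !) · ℕ→ℚ (k !)) ≡ falling² x N k
binom²-! x N k = trans (lemma (binom x k) (binom (- 1ℚ - x) k) (N ^ k) (ℕ→ℚ (k !)))
  (cong₂ (λ y z → y · z · (N ^ k)) (binom-! x k) (binom-! (- 1ℚ - x) k))
  where
  lemma : ∀ a b e f → a · b · e · (f · f) ≡ a · f · (b · f) · e
  lemma = solve-∀ ℚ-ring

-- The constant is chosen so that the ratio of consecutive terms is integral: `27 (k + 1/3)(k + 2/3)
-- = 3 (3k + 1)(3k + 2)`, and the `k + 1` from the factorial completes `(3k + 1)(3k + 2)(3k + 3)`.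
falling²-⅓ : ∀ k → falling² -⅓ (ℕ→ℚ 27) k · ℕ→ℚ (k !) ≡ ℕ→ℚ ((3 * k) !)
falling²-⅓ zero    = refl
falling²-⅓ (suc k) = begin
  falling² -⅓ (ℕ→ℚ 27) (suc k) · ℕ→ℚ (suc k !)
    ≡⟨ cong₂ _·_ (falling²-suc -⅓ (ℕ→ℚ 27) k) (suc-! k) ⟩
  ℕ→ℚ 27 · (-⅓ - K) · (- 1ℚ - -⅓ - K) · F · ((K + 1ℚ) · ℕ→ℚ (k !))
    ≡⟨ lemma₁ (ℕ→ℚ 27 · (-⅓ - K) · (- 1ℚ - -⅓ - K)) F (K + 1ℚ) (ℕ→ℚ (k !)) ⟩
  ℕ→ℚ 27 · (-⅓ - K) · (- 1ℚ - -⅓ - K) · (K + 1ℚ) · (F · ℕ→ℚ (k !))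
    ≡⟨ cong₂ _·_ (lemma₂ K) (falling²-⅓ k) ⟩
  rising (ℕ→ℚ 3 · K) 3 · ℕ→ℚ ((3 * k) !)
    ≡⟨ *-suc-! 3 k ⟨
  ℕ→ℚ ((3 * suc k) !) ∎
  where
  open ≡-Reasoning
  K = ℕ→ℚ k
  F = falling² -⅓ (ℕ→ℚ 27) k
  lemma₁ : ∀ a f b x → a · f · (b · x) ≡ a · b · (f · x)
  lemma₁ = solve-∀ ℚ-ring
  lemma₂ : ∀ K → ℕ→ℚ 27 · (-⅓ - K) · (- 1ℚ - -⅓ - K) · (K + 1ℚ)
    ≡ (ℕ→ℚ 3 · K + ℕ→ℚ 3) · ((ℕ→ℚ 3 · K + ℕ→ℚ 2) · ((ℕ→ℚ 3 · K + ℕ→ℚ 1) · 1ℚ))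
  lemma₂ = solve-∀ ℚ-ring

-- Here `64 (k + 1/4)(k + 3/4) = 4 (4k + 1)(4k + 3)` supplies the odd factors of `(4k + 4)! /
-- (4k)!`; the ratio `(2k + 1)(2k + 2)` of `(2k)!`, times 4, supplies the even ones.
falling²-¼ : ∀ k → falling² -¼ (ℕ→ℚ 64) k · ℕ→ℚ ((2 * k) !) ≡ ℕ→ℚ ((4 * k) !)
falling²-¼ zero    = refl
falling²-¼ (suc k) = begin
  falling² -¼ (ℕ→ℚ 64) (suc k) · ℕ→ℚ ((2 * suc k) !)
    ≡⟨ cong₂ _·_ (falling²-suc -¼ (ℕ→ℚ 64) k) (*-suc-! 2 k) ⟩
  ℕ→ℚ 64 · (-¼ - K) · (- 1ℚ - -¼ - K) · F · (rising (ℕ→ℚ 2 · K) 2 · ℕ→ℚ ((2 * k) !))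
    ≡⟨ lemma₁ (ℕ→ℚ 64 · (-¼ - K) · (- 1ℚ - -¼ - K)) F (rising (ℕ→ℚ 2 · K) 2) (ℕ→ℚ ((2 * k) !)) ⟩
  ℕ→ℚ 64 · (-¼ - K) · (- 1ℚ - -¼ - K) · rising (ℕ→ℚ 2 · K) 2 · (F · ℕ→ℚ ((2 * k) !))
    ≡⟨ cong₂ _·_ (lemma₂ K) (falling²-¼ k) ⟩
  rising (ℕ→ℚ 4 · K) 4 · ℕ→ℚ ((4 * k) !)
    ≡⟨ *-suc-! 4 k ⟨
  ℕ→ℚ ((4 * suc k) !) ∎
  where
  open ≡-Reasoning
  K = ℕ→ℚ k
  F = falling² -¼ (ℕ→ℚ 64) k
  lemma₁ : ∀ a f b x → a · f · (b · x) ≡ a · b · (f · x)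
  lemma₁ = solve-∀ ℚ-ring
  lemma₂ : ∀ K → ℕ→ℚ 64 · (-¼ - K) · (- 1ℚ - -¼ - K) · ((ℕ→ℚ 2 · K + ℕ→ℚ 2) · ((ℕ→ℚ 2 · K + ℕ→ℚ 1) · 1ℚ))
    ≡ (ℕ→ℚ 4 · K + ℕ→ℚ 4) · ((ℕ→ℚ 4 · K + ℕ→ℚ 3) · ((ℕ→ℚ 4 · K + ℕ→ℚ 2) · ((ℕ→ℚ 4 · K + ℕ→ℚ 1) · 1ℚ)))
  lemma₂ = solve-∀ ℚ-ring

-- Here `432 (k + 1/6)(k + 5/6) = 12 (6k + 1)(6k + 5)` supplies the factors prime to 6. The others
-- come from `(3k)!` and `(2k)!`, which both cover the multiples of 6; hence the `k !` on the right.
falling²-⅙ : ∀ k → falling² -⅙ (ℕ→ℚ 432) k · (ℕ→ℚ ((3 * k) !) · ℕ→ℚ ((2 * k) !)) ≡ ℕ→ℚ ((6 * k) !) · ℕ→ℚ (k !)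
falling²-⅙ zero    = refl
falling²-⅙ (suc k) = begin
  falling² -⅙ (ℕ→ℚ 432) (suc k) · (ℕ→ℚ ((3 * suc k) !) · ℕ→ℚ ((2 * suc k) !))
    ≡⟨ cong₂ _·_ (falling²-suc -⅙ (ℕ→ℚ 432) k) (cong₂ _·_ (*-suc-! 3 k) (*-suc-! 2 k)) ⟩
  ℕ→ℚ 432 · (-⅙ - K) · (- 1ℚ - -⅙ - K) · F · (rising (ℕ→ℚ 3 · K) 3 · ℕ→ℚ ((3 * k) !) · (rising (ℕ→ℚ 2 · K) 2 · ℕ→ℚ ((2 * k) !)))
    ≡⟨ lemma₁ (ℕ→ℚ 432 · (-⅙ - K) · (- 1ℚ - -⅙ - K)) F (rising (ℕ→ℚ 3 · K) 3) (ℕ→ℚ ((3 * k) !)) (rising (ℕ→ℚ 2 · K) 2) (ℕ→ℚ ((2 * k) !)) ⟩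
  ℕ→ℚ 432 · (-⅙ - K) · (- 1ℚ - -⅙ - K) · (rising (ℕ→ℚ 3 · K) 3 · rising (ℕ→ℚ 2 · K) 2) · (F · (ℕ→ℚ ((3 * k) !) · ℕ→ℚ ((2 * k) !)))
    ≡⟨ cong₂ _·_ (lemma₂ K) (falling²-⅙ k) ⟩
  rising (ℕ→ℚ 6 · K) 6 · (K + 1ℚ) · (ℕ→ℚ ((6 * k) !) · ℕ→ℚ (k !))
    ≡⟨ lemma₃ (rising (ℕ→ℚ 6 · K) 6) (K + 1ℚ) (ℕ→ℚ ((6 * k) !)) (ℕ→ℚ (k !)) ⟩
  rising (ℕ→ℚ 6 · K) 6 · ℕ→ℚ ((6 * k) !) · ((K + 1ℚ) · ℕ→ℚ (k !))
    ≡⟨ cong₂ _·_ (*-suc-! 6 k) (suc-! k) ⟨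
  ℕ→ℚ ((6 * suc k) !) · ℕ→ℚ (suc k !) ∎
  where
  open ≡-Reasoning
  K = ℕ→ℚ k
  F = falling² -⅙ (ℕ→ℚ 432) k
  lemma₁ : ∀ a f b x c y → a · f · (b · x · (c · y)) ≡ a · (b · c) · (f · (x · y))
  lemma₁ = solve-∀ ℚ-ring
  lemma₂ : ∀ K → ℕ→ℚ 432 · (-⅙ - K) · (- 1ℚ - -⅙ - K) ·
      ((ℕ→ℚ 3 · K + ℕ→ℚ 3) · ((ℕ→ℚ 3 · K + ℕ→ℚ 2) · ((ℕ→ℚ 3 · K + ℕ→ℚ 1) · 1ℚ)) · ((ℕ→ℚ 2 · K + ℕ→ℚ 2) · ((ℕ→ℚ 2 · K + ℕ→ℚ 1) · 1ℚ)))
    ≡ (ℕ→ℚ 6 · K + ℕ→ℚ 6) · ((ℕ→ℚ 6 · K + ℕ→ℚ 5) · ((ℕ→ℚ 6 · K + ℕ→ℚ 4) ·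
      ((ℕ→ℚ 6 · K + ℕ→ℚ 3) · ((ℕ→ℚ 6 · K + ℕ→ℚ 2) · ((ℕ→ℚ 6 · K + ℕ→ℚ 1) · 1ℚ))))) · (K + 1ℚ)
  lemma₂ = solve-∀ ℚ-ring
  lemma₃ : ∀ a b x y → a · b · (x · y) ≡ a · x · (b · y)
  lemma₃ = solve-∀ ℚ-ring

C-3k-k : ∀ k → ℕ→ℚ ((3 * k) C k) · (ℕ→ℚ (k !) · ℕ→ℚ ((2 * k) !)) ≡ ℕ→ℚ ((3 * k) !)
C-3k-k k = C-+-!ℚ k (2 * k)

C-4k-2k : ∀ k → ℕ→ℚ ((4 * k) C (2 * k)) · (ℕ→ℚ ((2 * k) !) · ℕ→ℚ ((2 * k) !)) ≡ ℕ→ℚ ((4 * k) !)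
C-4k-2k k = subst (λ n → ℕ→ℚ (n C (2 * k)) · (ℕ→ℚ ((2 * k) !) · ℕ→ℚ ((2 * k) !)) ≡ ℕ→ℚ (n !))
  (sym (ℕ.*-distribʳ-+ k 2 2)) (C-+-!ℚ (2 * k) (2 * k))

C-6k-3k : ∀ k → ℕ→ℚ ((6 * k) C (3 * k)) · (ℕ→ℚ ((3 * k) !) · ℕ→ℚ ((3 * k) !)) ≡ ℕ→ℚ ((6 * k) !)
C-6k-3k k = subst (λ n → ℕ→ℚ (n C (3 * k)) · (ℕ→ℚ ((3 * k) !) · ℕ→ℚ ((3 * k) !)) ≡ ℕ→ℚ (n !))
  (sym (ℕ.*-distribʳ-+ k 3 3)) (C-+-!ℚ (3 * k) (3 * k))

binom²-⅓ : ∀ k → binom -⅓ k · binom (- 1ℚ - -⅓) k · (ℕ→ℚ 27 ^ k) ≡ ℕ→ℚ (((2 * k) C k) * ((3 * k) C k))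
binom²-⅓ k = ·-cancelʳ _ _ (≢0-· (≢0-· (!≢0ℚ k) (!≢0ℚ k)) (!≢0ℚ k)) (begin
  b · (k! · k! · k!)                  ≡⟨ ℚ.*-assoc b (k! · k!) k! ⟨
  b · (k! · k!) · k!                  ≡⟨ cong (_· k!) (binom²-! -⅓ (ℕ→ℚ 27) k) ⟩
  falling² -⅓ (ℕ→ℚ 27) k · k!         ≡⟨ falling²-⅓ k ⟩
  ℕ→ℚ ((3 * k) !)                     ≡⟨ C-3k-k k ⟨
  c₃ · (k! · ℕ→ℚ ((2 * k) !))         ≡⟨ cong (λ x → c₃ · (k! · x)) (C-2k-k k) ⟨
  c₃ · (k! · (c₂ · (k! · k!)))        ≡⟨ lemma c₃ c₂ k! ⟩
  c₂ · c₃ · (k! · k! · k!)            ≡⟨ cong (_· (k! · k! · k!)) (ℕ→ℚ-* ((2 * k) C k) ((3 * k) C k)) ⟨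
  ℕ→ℚ (((2 * k) C k) * ((3 * k) C k)) · (k! · k! · k!) ∎)
  where
  open ≡-Reasoning
  k! = ℕ→ℚ (k !)
  b  = binom -⅓ k · binom (- 1ℚ - -⅓) k · (ℕ→ℚ 27 ^ k)
  c₂ = ℕ→ℚ ((2 * k) C k)
  c₃ = ℕ→ℚ ((3 * k) C k)
  lemma : ∀ a b x → a · (x · (b · (x · x))) ≡ b · a · (x · x · x)
  lemma = solve-∀ ℚ-ring

binom²-¼ : ∀ k → binom -¼ k · binom (- 1ℚ - -¼) k · (ℕ→ℚ 64 ^ k) ≡ ℕ→ℚ (((2 * k) C k) * ((4 * k) C (2 * k)))
binom²-¼ k = ·-cancelʳ _ _ (≢0-· (≢0-· (!≢0ℚ k) (!≢0ℚ k)) (!≢0ℚ (2 * k))) (begin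
  b · (k! · k! · 2k!)                 ≡⟨ ℚ.*-assoc b (k! · k!) 2k! ⟨
  b · (k! · k!) · 2k!                 ≡⟨ cong (_· 2k!) (binom²-! -¼ (ℕ→ℚ 64) k) ⟩
  falling² -¼ (ℕ→ℚ 64) k · 2k!        ≡⟨ falling²-¼ k ⟩
  ℕ→ℚ ((4 * k) !)                     ≡⟨ C-4k-2k k ⟨
  c₄ · (2k! · 2k!)                    ≡⟨ cong (λ x → c₄ · (x · 2k!)) (C-2k-k k) ⟨
  c₄ · (c₂ · (k! · k!) · 2k!)         ≡⟨ lemma c₄ c₂ k! 2k! ⟩
  c₂ · c₄ · (k! · k! · 2k!)           ≡⟨ cong (_· (k! · k! · 2k!)) (ℕ→ℚ-* ((2 * k) C k) ((4 * k) C (2 * k))) ⟨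
  ℕ→ℚ (((2 * k) C k) * ((4 * k) C (2 * k))) · (k! · k! · 2k!) ∎)
  where
  open ≡-Reasoning
  k!  = ℕ→ℚ (k !)
  2k! = ℕ→ℚ ((2 * k) !)
  b   = binom -¼ k · binom (- 1ℚ - -¼) k · (ℕ→ℚ 64 ^ k)
  c₂  = ℕ→ℚ ((2 * k) C k)
  c₄  = ℕ→ℚ ((4 * k) C (2 * k))
  lemma : ∀ a b x y → a · (b · (x · x) · y) ≡ b · a · (x · x · y)
  lemma = solve-∀ ℚ-ring

binom²-⅙ : ∀ k → binom -⅙ k · binom (- 1ℚ - -⅙) k · (ℕ→ℚ 432 ^ k) ≡ ℕ→ℚ (((3 * k) C k) * ((6 * k) C (3 * k)))
binom²-⅙ k = ·-cancelʳ _ _ (≢0-· (≢0-· (!≢0ℚ k) (!≢0ℚ k)) (≢0-· (!≢0ℚ (3 * k)) (!≢0ℚ (2 * k)))) (begin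
  b · (k! · k! · (3k! · 2k!))         ≡⟨ ℚ.*-assoc b (k! · k!) (3k! · 2k!) ⟨
  b · (k! · k!) · (3k! · 2k!)         ≡⟨ cong (_· (3k! · 2k!)) (binom²-! -⅙ (ℕ→ℚ 432) k) ⟩
  falling² -⅙ (ℕ→ℚ 432) k · (3k! · 2k!) ≡⟨ falling²-⅙ k ⟩
  ℕ→ℚ ((6 * k) !) · k!                ≡⟨ cong (_· k!) (C-6k-3k k) ⟨
  c₆ · (3k! · 3k!) · k!               ≡⟨ cong (λ x → c₆ · (x · 3k!) · k!) (C-3k-k k) ⟨
  c₆ · (c₃ · (k! · 2k!) · 3k!) · k!   ≡⟨ lemma c₆ c₃ k! 2k! 3k! ⟩
  c₃ · c₆ · (k! · k! · (3k! · 2k!))   ≡⟨ cong (_· (k! · k! · (3k! · 2k!))) (ℕ→ℚ-* ((3 * k) C k) ((6 * k) C (3 * k))) ⟨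
  ℕ→ℚ (((3 * k) C k) * ((6 * k) C (3 * k))) · (k! · k! · (3k! · 2k!)) ∎)
  where
  open ≡-Reasoning
  k!  = ℕ→ℚ (k !)
  2k! = ℕ→ℚ ((2 * k) !)
  3k! = ℕ→ℚ ((3 * k) !)
  b   = binom -⅙ k · binom (- 1ℚ - -⅙) k · (ℕ→ℚ 432 ^ k)
  c₃  = ℕ→ℚ ((3 * k) C k)
  c₆  = ℕ→ℚ ((6 * k) C (3 * k))
  lemma : ∀ a b x y z → a · (b · (x · y) · z) · x ≡ b · a · (x · x · (z · y))
  lemma = solve-∀ ℚ-ring

odd-prime : ∀ {p} → Prime p → p ≢ 2 → ∃[ n ] p ≡ suc (2 * n)
odd-prime {p} p-prime p≢2 = cases (p % 2) (m%n<n p 2) (m≡m%n+[m/n]*n p 2)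
  where
  cases : ∀ r → r < 2 → p ≡ r ℕ.+ (p / 2) * 2 → ∃[ n ] p ≡ suc (2 * n)
  cases 0 _ eq = contradiction (prime⇒irreducible p-prime (divides (p / 2) eq)) λ where
    (inj₁ ())
    (inj₂ 2≡p) → p≢2 (sym 2≡p)
  cases 1 _ eq = p / 2 , trans eq (cong suc (ℕ.*-comm (p / 2) 2))
  cases (suc (suc _)) (s≤s (s≤s ())) _

-- Legendre symbols and rescaled parameters

module Sums (p : ℕ) (p-prime : Prime p) (n : ℕ) (p≡1+2n : p ≡ suc (2 * n)) where
  open Congruence p p-prime
  open Binomials p p-prime
  open Odd p p-prime n p≡1+2n
  open Transform p p-prime n p≡1+2n

  ≉⇒¬Null : ∀ a b → ¬ Cong p a b → ¬ Null (a - b)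
  ≉⇒¬Null a b a≉b null-a-b = a≉b (≈⇒Cong {a} {b} (mk≈ null-a-b))

  ≉⇒¬Null′ : ∀ a b → ¬ Cong p a b → ¬ Null (b - a)
  ≉⇒¬Null′ a b a≉b null-b-a = a≉b (≈⇒Cong {a} {b} (≈-sym {b} {a} (mk≈ null-b-a)))

  ≉0⇒¬Null : ∀ {a} → ¬ Cong p a 0ℚ → ¬ Null a
  ≉0⇒¬Null {a} a≉0 null-a = a≉0 (≈⇒Cong (Null⇒≈0 null-a))

  Zp-product : ∀ {a x k} → k < p → Zp a → Zp x → Zp (a · binom x k · binom (- 1ℚ - x) k)
  Zp-product k<p za zx = Zp-· (Zp-· za (Zp-binom k<p zx)) (Zp-binom k<p (Zp--1-x zx))

  -- Replacing the half power by the symbol is a congruence between factors, so the sum that they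
  -- multiply has to be `p`-integral.
  legendre-sum : ∀ {L a f} → Zp a → ¬ Null a → (∀ k → k < p → Zp (f k)) →
    L ≈ (a ^ n) · sumQ p f → Cong p L (ℤ→ℚ (legendre p a) · sumQ p f)
  legendre-sum {f = f} za a≉0 zf eq = ≈⇒Cong (≈-trans eq (≈-·ʳ (Zp-sum p f zf) (≈-sym (euler za a≉0))))

  ¬Null-· : ∀ {a b} → Zp a → Zp b → ¬ Null a → ¬ Null b → ¬ Null (a · b)
  ¬Null-· za zb a≉0 b≉0 null-ab = [ a≉0 , b≉0 ]′ (Null-split za zb null-ab)

  cong-sum-G : ∀ m x → InZp p m → InZp p x → ¬ Cong p m 0ℚ → ¬ Cong p m 1ℚ →
    Cong p (sumQ p (λ k → G k x · inv (m ^ k)))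
           (sumQ p (λ k → binom x k · binom (- 1ℚ - x) k · inv ((1ℚ - m) ^ k)))
  cong-sum-G m x zm zx m≉0 m≉1 =
    ≈⇒Cong (sum-G/m^k m x (InZp⇒Zp zm) (InZp⇒Zp zx) (≉0⇒¬Null m≉0) (≉⇒¬Null′ m 1ℚ m≉1))

  cong-sum-cG : ∀ m x → InZp p m → InZp p x → ¬ Cong p m (ℕ→ℚ 2) → ¬ Cong p m (- ℕ→ℚ 2) →
    Cong p (sumQ p (λ k → c k · G k x · inv ((m + ℕ→ℚ 2) ^ k)))
           (ℤ→ℚ (legendre p ((m + ℕ→ℚ 2) · (m - ℕ→ℚ 2))) ·
             sumQ p (λ k → c k · binom x k · binom (- 1ℚ - x) k · inv ((ℕ→ℚ 2 - m) ^ k)))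
  cong-sum-cG m x zm zx m≉2 m≉-2 = legendre-sum (Zp-· zA zD) (¬Null-· zA zD A≉0 D≉0)
    (λ k k<p → Zp-· (Zp-product k<p (Zp-ℕ ((2 * k) C k)) (InZp⇒Zp zx)) (z-inv k))
    (≈-trans (sum-cG/A^k A D x zA (InZp⇒Zp zx) (lemma₁ m) A≉0 D≉0)
      (≈-reflexive (cong (((A · D) ^ n) ·_) (sumQ-cong p λ k _ →
        cong (λ d → c k · binom x k · binom (- 1ℚ - x) k · inv (d ^ k)) (lemma₂ m)))))
    where
    A = m + ℕ→ℚ 2
    D = m - ℕ→ℚ 2
    zA : Zp A
    zA = Zp-+ {m} {ℕ→ℚ 2} (InZp⇒Zp zm) (Zp-ℕ 2)
    zD : Zp D
    zD = Zp-∸ {m} {ℕ→ℚ 2} (InZp⇒Zp zm) (Zp-ℕ 2)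
    A≉0 : ¬ Null A
    A≉0 = ≉⇒¬Null m (- ℕ→ℚ 2) m≉-2
    D≉0 : ¬ Null D
    D≉0 = ≉⇒¬Null m (ℕ→ℚ 2) m≉2
    2-m≉0 : ¬ Null (ℕ→ℚ 2 - m)
    2-m≉0 = ≉⇒¬Null′ m (ℕ→ℚ 2) m≉2
    z-inv : ∀ k → Zp (inv ((ℕ→ℚ 2 - m) ^ k))
    z-inv k = subst Zp (sym (inv-^ (ℕ→ℚ 2 - m) k (≢0 2-m≉0)))
      (Zp-^ k (Zp-inv (Zp-∸ {ℕ→ℚ 2} {m} (Zp-ℕ 2) (InZp⇒Zp zm)) 2-m≉0))
    lemma₁ : ∀ m → m + ℕ→ℚ 2 - (m - ℕ→ℚ 2) ≡ ℕ→ℚ 4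
    lemma₁ = solve-∀ ℚ-ring
    lemma₂ : ∀ m → - (m - ℕ→ℚ 2) ≡ ℕ→ℚ 2 - m
    lemma₂ = solve-∀ ℚ-ring

  -- The three cases share one argument: `N^k G_k / m^k` is `G_k / (m/N)^k`, and `m/N` stays
  -- `p`-integral because `p` does not divide `N`. The values `e k` are the integers into which
  -- `N^k` turns the product of binomials.
  module Scaled (N : ℕ) (x : ℚ) (e : ℕ → ℕ) (p∤N : ¬ (p ∣ N)) (zx : Zp x)
    (binom²≡e : ∀ k → binom x k · binom (- 1ℚ - x) k · (ℕ→ℚ N ^ k) ≡ ℕ→ℚ (e k)) where

    private
      N′ = ℕ→ℚ N
      N≉0 : ¬ Null N′
      N≉0 null-N = p∤N (Null-ℕ⇒∣ N null-N)
      i = inv N′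
      zi : Zp i
      zi = Zp-inv (Zp-ℕ N) N≉0
      N·i : N′ · i ≡ 1ℚ
      N·i = q·inv (≢0 N≉0)
      i≉0 : ¬ Null i
      i≉0 null-i = Lagrange.¬Null-1 p p-prime (subst Null N·i (Null-· (Zp-ℕ N) null-i))

      scale-e : ∀ {a} k → ¬ Null a →
        binom x k · binom (- 1ℚ - x) k · inv ((a · i) ^ k) ≡ ℕ→ℚ (e k) · inv (a ^ k)
      scale-e {a} k a≉0 = begin
        b · inv ((a · i) ^ k)              ≡⟨ cong (b ·_) (inv-scale k (≢0 a≉0) (≢0 N≉0)) ⟩
        b · ((N′ ^ k) · inv (a ^ k))       ≡⟨ ℚ.*-assoc b (N′ ^ k) (inv (a ^ k)) ⟨
        b · (N′ ^ k) · inv (a ^ k)         ≡⟨ cong (_· inv (a ^ k)) (binom²≡e k) ⟩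
        ℕ→ℚ (e k) · inv (a ^ k)            ∎
        where
        open ≡-Reasoning
        b = binom x k · binom (- 1ℚ - x) k

      scale-G : ∀ {a} k → ¬ Null a → (N′ ^ k) · G k x · inv (a ^ k) ≡ G k x · inv ((a · i) ^ k)
      scale-G {a} k a≉0 = trans (lemma (N′ ^ k) (G k x) (inv (a ^ k)))
        (cong (G k x ·_) (sym (inv-scale k (≢0 a≉0) (≢0 N≉0))))
        where
        lemma : ∀ a b c → a · b · c ≡ b · (a · c)
        lemma = solve-∀ ℚ-ring

    corollary-G : ∀ m → InZp p m → ¬ Cong p m 0ℚ → ¬ Cong p m N′ →
      Cong p (sumQ p (λ k → (N′ ^ k) · G k x · inv (m ^ k)))
             (sumQ p (λ k → ℕ→ℚ (e k) · inv ((N′ - m) ^ k)))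
    corollary-G m in-m m≉0 m≉N = ≈⇒Cong (≈-trans
      (≈-reflexive (sumQ-cong p λ k _ → scale-G k (≉0⇒¬Null m≉0)))
      (≈-trans (sum-G/m^k (m · i) x (Zp-· zm zi) zx (¬Null-· zm zi (≉0⇒¬Null m≉0) i≉0)
                 (subst (λ y → ¬ Null y) (sym 1-mi) (¬Null-· (Zp-∸ (Zp-ℕ N) zm) zi N-m≉0 i≉0)))
        (≈-reflexive (sumQ-cong p λ k _ → trans
          (cong (λ y → binom x k · binom (- 1ℚ - x) k · inv (y ^ k)) 1-mi) (scale-e k N-m≉0)))))
      where
      zm : Zp m
      zm = InZp⇒Zp in-m
      N-m≉0 : ¬ Null (N′ - m)
      N-m≉0 = ≉⇒¬Null′ m N′ m≉N
      1-mi : 1ℚ - m · i ≡ (N′ - m) · i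
      1-mi = trans (cong (λ y → y - m · i) (sym N·i)) (lemma N′ m i)
        where
        lemma : ∀ a m i → a · i - m · i ≡ (a - m) · i
        lemma = solve-∀ ℚ-ring

    -- Here `A = m/N` and `D = (m - L)/N`, so the condition `A - D = 4` amounts to `L = 4N`. The
    -- separate `f` lets the integer product be bracketed as in the final statement.
    corollary-cG : ∀ L (f : ℕ → ℕ) → L ≡ 4 * N → (∀ k → f k ≡ ((2 * k) C k) * e k) →
      ∀ m → InZp p m → ¬ Cong p m 0ℚ → ¬ Cong p m (ℕ→ℚ L) →
      Cong p (sumQ p (λ k → c k · ((N′ ^ k) · G k x) · inv (m ^ k)))
             (ℤ→ℚ (legendre p (m · (m - ℕ→ℚ L))) · sumQ p (λ k → ℕ→ℚ (f k) · inv ((ℕ→ℚ L - m) ^ k)))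
    corollary-cG L f L≡4N f≡ce m in-m m≉0 m≉L = legendre-sum (Zp-· zm z[m-L]) (¬Null-· zm z[m-L] (≉0⇒¬Null m≉0) m-L≉0)
      (λ k _ → Zp-· (Zp-ℕ (f k)) (z-inv k))
      (≈-trans (≈-reflexive (sumQ-cong p λ k _ → left k))
        (≈-trans (sum-cG/A^k (m · i) ((m - L′) · i) x (Zp-· zm zi) zx A-D≡4
                   (¬Null-· zm zi (≉0⇒¬Null m≉0) i≉0) (¬Null-· z[m-L] zi m-L≉0 i≉0))
          (≈-trans (≈-reflexive (cong ((((m · i) · ((m - L′) · i)) ^ n) ·_) (sumQ-cong p λ k _ → right k)))
            (≈-·ʳ (Zp-sum p _ λ k _ → Zp-· (Zp-ℕ (f k)) (z-inv k)) power))))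
      where
      L′ = ℕ→ℚ L
      zm : Zp m
      zm = InZp⇒Zp in-m
      z[m-L] : Zp (m - L′)
      z[m-L] = Zp-∸ zm (Zp-ℕ L)
      m-L≉0 : ¬ Null (m - L′)
      m-L≉0 = ≉⇒¬Null m L′ m≉L
      L-m≉0 : ¬ Null (L′ - m)
      L-m≉0 = ≉⇒¬Null′ m L′ m≉L
      z-inv : ∀ k → Zp (inv ((L′ - m) ^ k))
      z-inv k = subst Zp (sym (inv-^ (L′ - m) k (≢0 L-m≉0))) (Zp-^ k (Zp-inv (Zp-∸ (Zp-ℕ L) zm) L-m≉0))
      open ≡-Reasoning
      left : ∀ k → c k · ((N′ ^ k) · G k x) · inv (m ^ k) ≡ c k · G k x · inv ((m · i) ^ k)
      left k = begin
        c k · ((N′ ^ k) · G k x) · inv (m ^ k)     ≡⟨ ℚ.*-assoc (c k) ((N′ ^ k) · G k x) (inv (m ^ k)) ⟩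
        c k · ((N′ ^ k) · G k x · inv (m ^ k))     ≡⟨ cong (c k ·_) (scale-G k (≉0⇒¬Null m≉0)) ⟩
        c k · (G k x · inv ((m · i) ^ k))          ≡⟨ ℚ.*-assoc (c k) (G k x) (inv ((m · i) ^ k)) ⟨
        c k · G k x · inv ((m · i) ^ k)            ∎
      A-D≡4 : m · i - (m - L′) · i ≡ ℕ→ℚ 4
      A-D≡4 = begin
        m · i - (m - L′) · i        ≡⟨ lemma m L′ i ⟩
        L′ · i                      ≡⟨ cong (_· i) (trans (cong ℕ→ℚ L≡4N) (ℕ→ℚ-* 4 N)) ⟩
        ℕ→ℚ 4 · N′ · i              ≡⟨ ℚ.*-assoc (ℕ→ℚ 4) N′ i ⟩
        ℕ→ℚ 4 · (N′ · i)            ≡⟨ cong (ℕ→ℚ 4 ·_) N·i ⟩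
        ℕ→ℚ 4 · 1ℚ                  ≡⟨ ℚ.*-identityʳ (ℕ→ℚ 4) ⟩
        ℕ→ℚ 4                       ∎
        where
        lemma : ∀ m l i → m · i - (m - l) · i ≡ l · i
        lemma = solve-∀ ℚ-ring
      right : ∀ k → c k · binom x k · binom (- 1ℚ - x) k · inv ((- ((m - L′) · i)) ^ k) ≡ ℕ→ℚ (f k) · inv ((L′ - m) ^ k)
      right k = begin
        c k · binom x k · binom (- 1ℚ - x) k · inv ((- ((m - L′) · i)) ^ k)
          ≡⟨ cong (λ y → c k · binom x k · binom (- 1ℚ - x) k · inv (y ^ k)) (lemma₁ m L′ i) ⟩
        c k · binom x k · binom (- 1ℚ - x) k · inv (((L′ - m) · i) ^ k)
          ≡⟨ lemma₂ (c k) (binom x k) (binom (- 1ℚ - x) k) (inv (((L′ - m) · i) ^ k)) ⟩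
        c k · (binom x k · binom (- 1ℚ - x) k · inv (((L′ - m) · i) ^ k))
          ≡⟨ cong (c k ·_) (scale-e k L-m≉0) ⟩
        c k · (ℕ→ℚ (e k) · inv ((L′ - m) ^ k))
          ≡⟨ ℚ.*-assoc (c k) (ℕ→ℚ (e k)) (inv ((L′ - m) ^ k)) ⟨
        c k · ℕ→ℚ (e k) · inv ((L′ - m) ^ k)
          ≡⟨ cong (_· inv ((L′ - m) ^ k)) (trans (cong ℕ→ℚ (f≡ce k)) (ℕ→ℚ-* ((2 * k) C k) (e k))) ⟨
        ℕ→ℚ (f k) · inv ((L′ - m) ^ k) ∎
        where
        lemma₁ : ∀ m l i → - ((m - l) · i) ≡ (l - m) · i
        lemma₁ = solve-∀ ℚ-ring
        lemma₂ : ∀ c a b d → c · a · b · d ≡ c · (a · b · d)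
        lemma₂ = solve-∀ ℚ-ring
      -- Rescaling multiplies the argument of the symbol by the square `i · i`, whose half power is
      -- congruent to 1.
      power : ((m · i) · ((m - L′) · i)) ^ n ≈ (m · (m - L′)) ^ n
      power = ≈-trans (≈-reflexive (begin
        ((m · i) · ((m - L′) · i)) ^ n               ≡⟨ cong (_^ n) (lemma m (m - L′) i) ⟩
        ((m · (m - L′)) · (i · i)) ^ n               ≡⟨ ^-distribʳ-· (m · (m - L′)) (i · i) n ⟩
        ((m · (m - L′)) ^ n) · ((i · i) ^ n)         ≡⟨ cong (((m · (m - L′)) ^ n) ·_) (^-distribʳ-· i i n) ⟩
        ((m · (m - L′)) ^ n) · ((i ^ n) · (i ^ n))   ∎))
        (≈-trans (≈-·ˡ (Zp-^ n (Zp-· zm z[m-L])) (half-power² zi i≉0))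
          (≈-reflexive (ℚ.*-identityʳ ((m · (m - L′)) ^ n))))
        where
        lemma : ∀ m d i → (m · i) · (d · i) ≡ (m · d) · (i · i)
        lemma = solve-∀ ℚ-ring

  -- The scales 27, 64, 432 and the denominators 3, 4, 6 have no prime factors besides 2 and 3, so
  -- `p > 3` makes all of them units.
  module Large (3<p : 3 < p) where
    p∤2 : ¬ (p ∣ 2)
    p∤2 p∣2 = ℕ.<⇒≱ 2<p (∣⇒≤ p∣2)

    p∤3 : ¬ (p ∣ 3)
    p∤3 p∣3 = ℕ.<⇒≱ 3<p (∣⇒≤ p∣3)

    ∤-* : ∀ {a b} → ¬ (p ∣ a) → ¬ (p ∣ b) → ¬ (p ∣ a * b)
    ∤-* {a} {b} p∤a p∤b p∣ab = [ p∤a , p∤b ]′ (euclidsLemma a b p-prime p∣ab)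

    p∤4 : ¬ (p ∣ 4)
    p∤4 = ∤-* {2} {2} p∤2 p∤2

    p∤6 : ¬ (p ∣ 6)
    p∤6 = ∤-* {2} {3} p∤2 p∤3

    p∤12 : ¬ (p ∣ 12)
    p∤12 = ∤-* {2} {6} p∤2 p∤6

    module S₃ = Scaled 27 -⅓ (λ k → ((2 * k) C k) * ((3 * k) C k))
      (∤-* {3} {9} p∤3 (∤-* {3} {3} p∤3 p∤3)) (InZp⇒Zp p∤3) binom²-⅓
    module S₄ = Scaled 64 -¼ (λ k → ((2 * k) C k) * ((4 * k) C (2 * k)))
      (∤-* {4} {16} p∤4 (∤-* {4} {4} p∤4 p∤4)) (InZp⇒Zp p∤4) binom²-¼
    module S₆ = Scaled 432 -⅙ (λ k → ((3 * k) C k) * ((6 * k) C (3 * k)))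
      (∤-* {6} {72} p∤6 (∤-* {6} {12} p∤6 p∤12)) (InZp⇒Zp p∤6) binom²-⅙

theorem3p7 : (p : ℕ) → Prime p → p ≢ 2 →
    ((m x : ℚ) → InZp p m → InZp p x →
    ¬ Cong p m 0ℚ → ¬ Cong p m 1ℚ →
    Cong p (sumQ p (λ k → G k x Data.Rational.* inv (m ^ k)))
    (sumQ p (λ k → binom x k Data.Rational.* binom (- 1ℚ - x) k
    Data.Rational.* inv ((1ℚ - m) ^ k))))
    × ((m x : ℚ) → InZp p m → InZp p x →
    ¬ Cong p m (ℕ→ℚ 2) → ¬ Cong p m (- ℕ→ℚ 2) →
    Cong p (sumQ p (λ k → ℕ→ℚ ((2 * k) C k) Data.Rational.* G k x
    Data.Rational.* inv ((m + ℕ→ℚ 2) ^ k)))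
    (ℤ→ℚ (legendre p ((m + ℕ→ℚ 2) Data.Rational.* (m - ℕ→ℚ 2)))
    Data.Rational.* sumQ p (λ k → ℕ→ℚ ((2 * k) C k)
    Data.Rational.* binom x k Data.Rational.* binom (- 1ℚ - x) k
    Data.Rational.* inv ((ℕ→ℚ 2 - m) ^ k))))
    × (3 < p →
    ((m : ℚ) → InZp p m → ¬ Cong p m 0ℚ → ¬ Cong p m (ℕ→ℚ 27) →
    Cong p (sumQ p (λ k → G3 k Data.Rational.* inv (m ^ k)))
    (sumQ p (λ k → ℕ→ℚ (((2 * k) C k) * ((3 * k) C k))
    Data.Rational.* inv ((ℕ→ℚ 27 - m) ^ k))))
    × ((m : ℚ) → InZp p m → ¬ Cong p m 0ℚ → ¬ Cong p m (ℕ→ℚ 64) →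
    Cong p (sumQ p (λ k → G4 k Data.Rational.* inv (m ^ k)))
    (sumQ p (λ k → ℕ→ℚ (((2 * k) C k) * ((4 * k) C (2 * k)))
    Data.Rational.* inv ((ℕ→ℚ 64 - m) ^ k))))
    × ((m : ℚ) → InZp p m → ¬ Cong p m 0ℚ → ¬ Cong p m (ℕ→ℚ 432) →
    Cong p (sumQ p (λ k → G6 k Data.Rational.* inv (m ^ k)))
    (sumQ p (λ k → ℕ→ℚ (((3 * k) C k) * ((6 * k) C (3 * k)))
    Data.Rational.* inv ((ℕ→ℚ 432 - m) ^ k))))
    × ((m : ℚ) → InZp p m → ¬ Cong p m 0ℚ → ¬ Cong p m (ℕ→ℚ 108) →
    Cong p (sumQ p (λ k → ℕ→ℚ ((2 * k) C k) Data.Rational.* G3 k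
    Data.Rational.* inv (m ^ k)))
    (ℤ→ℚ (legendre p (m Data.Rational.* (m - ℕ→ℚ 108)))
    Data.Rational.* sumQ p (λ k →
    ℕ→ℚ (((2 * k) C k) * ((2 * k) C k) * ((3 * k) C k))
    Data.Rational.* inv ((ℕ→ℚ 108 - m) ^ k))))
    × ((m : ℚ) → InZp p m → ¬ Cong p m 0ℚ → ¬ Cong p m (ℕ→ℚ 256) →
    Cong p (sumQ p (λ k → ℕ→ℚ ((2 * k) C k) Data.Rational.* G4 k
    Data.Rational.* inv (m ^ k)))
    (ℤ→ℚ (legendre p (m Data.Rational.* (m - ℕ→ℚ 256)))
    Data.Rational.* sumQ p (λ k →
    ℕ→ℚ (((2 * k) C k) * ((2 * k) C k) * ((4 * k) C (2 * k)))
    Data.Rational.* inv ((ℕ→ℚ 256 - m) ^ k))))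
    × ((m : ℚ) → InZp p m → ¬ Cong p m 0ℚ → ¬ Cong p m (ℕ→ℚ 1728) →
    Cong p (sumQ p (λ k → ℕ→ℚ ((2 * k) C k) Data.Rational.* G6 k
    Data.Rational.* inv (m ^ k)))
    (ℤ→ℚ (legendre p (m Data.Rational.* (m - ℕ→ℚ 1728)))
    Data.Rational.* sumQ p (λ k →
    ℕ→ℚ (((2 * k) C k) * ((3 * k) C k) * ((6 * k) C (3 * k)))
    Data.Rational.* inv ((ℕ→ℚ 1728 - m) ^ k)))))
theorem3p7 p p-prime p≢2 =
    cong-sum-G
  , cong-sum-cG
  , λ 3<p → let open Large 3<p in
      -- `G3`, `G4` and `G6` unfold to `N^k` times `G k x`, so the generic statements apply as they
      -- are.
      S₃.corollary-G
    , S₄.corollary-G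
    , S₆.corollary-G
    , S₃.corollary-cG 108 (λ k → ((2 * k) C k) * ((2 * k) C k) * ((3 * k) C k)) refl
        (λ k → ℕ.*-assoc ((2 * k) C k) ((2 * k) C k) ((3 * k) C k))
    , S₄.corollary-cG 256 (λ k → ((2 * k) C k) * ((2 * k) C k) * ((4 * k) C (2 * k))) refl
        (λ k → ℕ.*-assoc ((2 * k) C k) ((2 * k) C k) ((4 * k) C (2 * k)))
    , S₆.corollary-cG 1728 (λ k → ((2 * k) C k) * ((3 * k) C k) * ((6 * k) C (3 * k))) refl
        (λ k → ℕ.*-assoc ((2 * k) C k) ((3 * k) C k) ((6 * k) C (3 * k)))
  where open Sums p p-prime (proj₁ (odd-prime p-prime p≢2)) (proj₂ (odd-prime p-prime p≢2))
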